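{- Let $w_n$ be the number of weak-ordering chains in $\mathcal{WOC}(n)$ subject to the stopping condition $x_{i_1}\le x_{i_2}<x_{i_3}$ with $i_1<i_2<i_3$. Then \[ w_n=\sum_{d=0}^{n-1}2^dN_{n,d}+\sum_{j=3}^{n}\sum_{d=1}^{j-2}2^d\ell_{j,d}. \] The sequence starts $1,3,13,65,341,1827,9913,54273,299209,1658723,\dots$, and $W(x)=\sum_{n\ge1}w_nx^n$ satisfies \[ W(x)=\frac{(1-x)^2-(1-3x)\sqrt{1-6x+x^2}}{4(1-x)\sqrt{1-6x+x^2}}. \]
   Context: A weak-ordering chain on $x_1,\dots,x_m$ is an expression $x_{i_1}\,\mathrm{op}\,x_{i_2}\,\mathrm{op}\cdots\mathrm{op}\,x_{i_m}$, where $(i_1,\dots,i_m)$ is an ordering of $[m]$ and each $\mathrm{op}$ is $<$ or $=$; expressions defining the same ordered set partition of $[m]$ are identified. $\mathcal{WOC}(m)$ is the set of these chains. Each chain in $\mathcal{WOC}(m)$, $m\ge 2$, arises uniquely from its restriction to $x_1,\dots,x_{m-1}$ by inserting $x_m$; this gives a rooted tree with root $x_1$ whose level-$m$ nodes are the elements of $\mathcal{WOC}(m)$. The restricted generating tree of order $n$ for a stopping condition is the part of this tree up to level $n$ in which any node containing the stopping condition has no descendants; "the number of weak-ordering chains in $\mathcal{WOC}(n)$ subject to the stopping condition" is the number of leaves of this tree (nodes at level $n$ plus nodes containing the condition), equivalently the number of chains in $\mathcal{WOC}(n)$ avoiding the condition plus, for each $j\le n$, the number of chains in $\mathcal{WOC}(j)$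 containing the condition whose restriction to $x_1,\dots,x_{j-1}$ avoids it. Here a chain contains the stopping condition if there are indices $i_1<i_2<i_3$ such that $x_{i_1}<x_{i_2}$ or $x_{i_1}=x_{i_2}$, and $x_{i_2}<x_{i_3}$, in the chain. $N_{n,d}=\frac1n\binom{n}{d}\binom{n}{d+1}$ are the Narayana numbers. $\ell_{j,d}=|\mathcal{G}^d_j(213)|$, where for $j>3$, $1\le d\le j-2$, $\mathcal{G}^d_j(213)$ is the set of permutations $\sigma$ of $[j]$ that contain the pattern $213$ (indices $a<b<c$ with $\sigma(b)<\sigma(a)<\sigma(c)$), have exactly $d$ descents, and such that the permutation obtained by deleting $j$ avoids $213$; and $\mathcal{G}^1_3(213)=\{213\}$, so $\ell_{3,1}=1$. -}

module Defs where

open import Data.Nat using (ℕ; zero; suc; _+_; _*_; _∸_; _^_; _≡ᵇ_; _≤ᵇ_; _<ᵇ_; pred; NonZero)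
open import Data.Nat.DivMod using (_/_)
open import Data.Nat.Combinatorics using (_C_)
open import Data.Bool using (Bool; true; false; _∧_; _∨_; not)
open import Data.List using (List; []; _∷_; map; concatMap; upTo; filterᵇ; deduplicateᵇ; length; take)
open import Data.Bool.ListAction using (all; any)
open import Data.Nat.ListAction using (sum)
open import Data.Integer as ℤ using (ℤ)

sumFromTo : ℕ → ℕ → (ℕ → ℕ) → ℕ
sumFromTo a b f = sum (map (λ i → f (a + i)) (upTo (suc b ∸ a)))

count : {A : Set} → (A → Bool) → List A → ℕ
count p xs = length (filterᵇ p xs)

-- i-th entry of a list (0-indexed; 0 out of range, never used out of range)
at : List ℕ → ℕ → ℕ
at []       _       = 0
at (x ∷ _)  zero    = x
at (_ ∷ xs) (suc n) = at xs n

lists : ℕ → ℕ → List (List ℕ)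
lists zero    k = [] ∷ []
lists (suc m) k = concatMap (λ v → map (v ∷_) (lists m k)) (upTo k)

anyTriple : ℕ → (ℕ → ℕ → ℕ → Bool) → Bool
anyTriple m p = any (λ k → any (λ j → any (λ i → p i j k) (upTo j)) (upTo k)) (upTo m)

-- Weak-ordering chains.
-- A chain on x_1,…,x_m (an ordered set partition of [m]) is encoded
-- canonically by its rank list r = (r_1,…,r_m): r_i is the index (from 0)
-- of the block containing x_i.  Then x_i < x_j iff r_i < r_j and
-- x_i = x_j iff r_i = r_j.  Valid rank lists are exactly those whose set
-- of values is {0,…,k-1} for some k.

validRanks : List ℕ → Bool
validRanks r = all (λ v → (v ≡ᵇ 0) ∨ any (λ u → u ≡ᵇ pred v) r) r

WOC : ℕ → List (List ℕ)
WOC m = filterᵇ validRanks (lists m m)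

containsStop : List ℕ → Bool
containsStop r = anyTriple (length r)
  (λ i j k → (at r i ≤ᵇ at r j) ∧ (at r j <ᵇ at r k))

-- canonical rank list of an arbitrary list of naturals (same comparisons)
standardize : List ℕ → List ℕ
standardize l = map (λ v → length (deduplicateᵇ _≡ᵇ_ (filterᵇ (λ u → u <ᵇ v) l))) l

restrict : List ℕ → List ℕ
restrict r = standardize (take (length r ∸ 1) r)

-- number of leaves of the restricted generating tree of order n
w : ℕ → ℕ
w n = count (λ c → not (containsStop c)) (WOC n)
    + sumFromTo 1 n (λ j → count (λ c → containsStop c ∧ not (containsStop (restrict c))) (WOC j))

-- Narayana numbers N_{n,d} = (1/n) C(n,d) C(n,d+1)  (n ≥ 1; exact division)

narayana : ℕ → ℕ → ℕ
narayana zero    d = 0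
narayana (suc n) d = ((suc n C d) * (suc n C suc d)) / suc n

-- ℓ_{j,d}.  A permutation σ of [j] is encoded as the list
-- (σ(1)-1,…,σ(j)-1), a list of distinct entries in {0,…,j-1}.

distinct : List ℕ → Bool
distinct []       = true
distinct (x ∷ xs) = not (any (λ y → x ≡ᵇ y) xs) ∧ distinct xs

perms : ℕ → List (List ℕ)
perms j = filterᵇ distinct (lists j j)

contains213 : List ℕ → Bool
contains213 s = anyTriple (length s)
  (λ a b c → (at s b <ᵇ at s a) ∧ (at s a <ᵇ at s c))

descents : List ℕ → ℕ
descents s = count (λ i → at s (suc i) <ᵇ at s i) (upTo (length s ∸ 1))

deleteMax : ℕ → List ℕ → List ℕ
deleteMax j s = filterᵇ (λ v → not (v ≡ᵇ (j ∸ 1))) s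

ell : ℕ → ℕ → ℕ
ell j d = count (λ s → contains213 s ∧ (descents s ≡ᵇ d) ∧ not (contains213 (deleteMax j s))) (perms j)

wFormula : ℕ → ℕ
wFormula n = sumFromTo 0 (n ∸ 1) (λ d → 2 ^ d * narayana n d)
           + sumFromTo 3 n (λ j → sumFromTo 1 (j ∸ 2) (λ d → 2 ^ d * ell j d))

FPS : Set
FPS = ℕ → ℤ

_⊛_ : FPS → FPS → FPS
(f ⊛ g) n = Data.List.foldr ℤ._+_ (ℤ.+ 0) (map (λ i → f i ℤ.* g (n ∸ i)) (upTo (suc n)))

poly : List ℤ → FPS
poly []       _       = ℤ.+ 0
poly (c ∷ _)  zero    = c
poly (_ ∷ cs) (suc n) = poly cs n

Wseries : FPS
Wseries zero    = ℤ.+ 0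
Wseries (suc n) = ℤ.+ (w (suc n))

{-# OPTIONS --safe #-}

-- Insert x_n into a chain avoiding the stopping condition: only the positions up to the smallest entry known to
-- end a weak ascent keep avoiding it, so avoiding chains form a generating tree whose nodes are labelled by this
-- bound and the number of blocks.  Inserting n into a 213-avoiding permutation gives a generating tree labelled by
-- the initial increasing run, the descents and the non-descents.  Both trees are described by the same counts
-- F m i φ, with a descent standing for two chains (blocks merged across it or not).  An avoiding chain with k
-- blocks has 2k + 1 children, which turns the leaves containing the condition into a weighted sum over avoiding
-- nodes, on both sides; it also gives w (n + 1) = w n + 2 K n, where K n is the total number of blocks of the
-- avoiding chains on n elements.  The Narayana sum is F n 0 1 because the refined numbers have a determinant
-- formula satisfying the same recursion.  Finally the series of F is geometric in i with ratio ρ = 1 + xρ + xρ²,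
-- and 1 - x - 2xρ is the square root of 1 - 6x + x².

module Submission where

open import Defs
open import Algebra.Bundles using (CommutativeRing)
import Algebra.Properties.CommutativeSemigroup
import Algebra.Properties.Group
import Algebra.Solver.Ring
open import Algebra.Solver.Ring.AlmostCommutativeRing using (fromCommutativeRing; _-Raw-AlmostCommutative⟶_)
open import Data.Bool using (Bool; true; false; T; _∧_; _∨_; not; if_then_else_)
open import Data.Bool.ListAction using (any)
open import Data.Bool.Properties using (T?; T-∧; T-∨; ∧-distribʳ-∨; ∧-identityʳ; ∧-zeroʳ; ∨-assoc; ∨-identityʳ; ∨-zeroʳ)
open import Data.Empty using (⊥-elim)
open import Data.List using (List; []; _∷_; _++_; _∷ʳ_; map; applyUpTo; upTo; concatMap; filterᵇ; deduplicateᵇ; foldr;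
    initLast; length; take; _∷ʳ′_)
open import Data.List.Membership.Propositional using (_∈_; find; lose)
open import Data.List.Membership.Propositional.Properties
open import Data.List.Membership.Propositional.Properties.WithK using (unique∧set⇒bag)
open import Data.List.Properties using (length-++; length-map; length-upTo; map-++; map-∘; map-applyUpTo; map-cong;
    map-id; map-id-local; map-upTo; upTo-∷ʳ; ∷-injective; ∷ʳ-injective; ∷ʳ-injectiveʳ)
open import Data.List.Relation.Binary.BagAndSetEquality using (∼bag⇒↭)
open import Data.List.Relation.Binary.Permutation.Propositional using (_↭_)
open import Data.List.Relation.Binary.Permutation.Propositional.Properties as Perm using (↭-length)
open import Data.List.Relation.Unary.All as All using (All; []; _∷_)
import Data.List.Relation.Unary.All.Properties as Allₚ
open import Data.List.Relation.Unary.AllPairs using ([]; _∷_)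
open import Data.List.Relation.Unary.Any as Any using (Any; here; there)
import Data.List.Relation.Unary.Any.Properties as Anyₚ
open import Data.List.Relation.Unary.Unique.Propositional using (Unique)
open import Data.List.Relation.Unary.Unique.Propositional.Properties as Uniq using (upTo⁺)
open import Data.Maybe using (Maybe; just; nothing)
open import Data.Nat
open import Data.Nat.Combinatorics using (_C_; nC1≡n; nCk+nC[k+1]≡[n+1]C[k+1]; k>n⇒nCk≡0)
open import Data.Nat.DivMod using (m*n/n≡m)
open import Data.Nat.ListAction using (sum)
open import Data.Nat.ListAction.Properties using (sum-++; sum-↭)
open import Data.Nat.Properties
open import Data.List.Membership.DecPropositional _≟_ using (_∈?_)
import Data.Nat.Tactic.RingSolver as ℕ-Solver
open import Data.Product using (_×_; _,_; proj₁; proj₂; ∃-syntax)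
open import Data.Sum using (_⊎_; inj₁; inj₂; [_,_]′)
open import Function using (_∘_; id; mk⇔; Equivalence)
open import Relation.Binary.Definitions using (tri<; tri≈; tri>)
open import Relation.Binary.PropositionalEquality
open import Relation.Nullary using (yes; no; ¬_)
open import Relation.Nullary.Decidable using (¬?)

-- No bijection between the two trees is built, and they do not match child by child. A 213-avoiding
-- permutation has one kind of node. Among chains, the strictly decreasing ones are the only ones
-- without a bound; every other insertion leads to a bounded node, counted by `R`. The recursion of
-- `F` is the difference in `i` of a sum over children: summed back it is the child sum of
-- permutations (`F-run-step`), and together with the exchange identity `R-F` it becomes the child
-- sum of chains (`F-chain-step`). The weight `φ` stays arbitrary because a new block replaces it by
-- `φ ∘ suc`, so an induction for the weight `siblings` alone would not close. For the series, the
-- weight `id` gives the recursion of the weight `one` plus a forcing term proportional to ρ^i,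
-- itself a homogeneous solution. This is the resonant case: the solution acquires a term i ρ^i, and
-- its denominator is what puts the square root into the denominator of W.

-- F m i φ and R m i φ sum φ (number of added blocks) over the avoiding chains obtained by m insertions: F from a
-- chain of i blocks in which every insertion is allowed, R from a chain whose bound is the entry i - 1.
F : ℕ → ℕ → (ℕ → ℕ) → ℕ
F zero    i       φ = φ 0
F (suc m) zero    φ = F m 1 (φ ∘ suc)
F (suc m) (suc i) φ = F (suc m) i φ + F m (suc (suc i)) (φ ∘ suc) + F m (suc i) φ

R : ℕ → ℕ → (ℕ → ℕ) → ℕ
R zero    i       φ = φ 0
R (suc m) zero    φ = 0
R (suc m) (suc i) φ = R (suc m) i φ + R m (suc (suc i)) (φ ∘ suc) + R m (suc i) φ

one : ℕ → ℕ
one _ = 1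

F-cong : ∀ m i {φ ψ} → (∀ k → φ k ≡ ψ k) → F m i φ ≡ F m i ψ
F-cong zero    i       e = e 0
F-cong (suc m) zero    e = F-cong m 1 (e ∘ suc)
F-cong (suc m) (suc i) e = cong₂ _+_ (cong₂ _+_ (F-cong (suc m) i e) (F-cong m (suc (suc i)) (e ∘ suc))) (F-cong m (suc i) e)

F-+ : ∀ m i φ ψ → F m i (λ k → φ k + ψ k) ≡ F m i φ + F m i ψ
F-+ zero    i       φ ψ = refl
F-+ (suc m) zero    φ ψ = F-+ m 1 (φ ∘ suc) (ψ ∘ suc)
F-+ (suc m) (suc i) φ ψ = trans
  (cong₂ _+_ (cong₂ _+_ (F-+ (suc m) i φ ψ) (F-+ m (suc (suc i)) (φ ∘ suc) (ψ ∘ suc))) (F-+ m (suc i) φ ψ))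
  (lem (F (suc m) i φ) (F (suc m) i ψ) _ _ _ _)
  where
  lem : ∀ a b c d e f → a + b + (c + d) + (e + f) ≡ (a + c + e) + (b + d + f)
  lem = ℕ-Solver.solve-∀

F-blocks-suc : ∀ m i → F m i suc ≡ F m i id + F m i one
F-blocks-suc m i = trans (F-cong m i (λ k → ℕ-lem k)) (F-+ m i id one)
  where
  ℕ-lem : ∀ k → suc k ≡ k + 1
  ℕ-lem = ℕ-Solver.solve-∀

-- Finite sums, and the recursions of `F` and `R` as sums over children

∑ : ℕ → (ℕ → ℕ) → ℕ
∑ zero    f = 0
∑ (suc n) f = ∑ n f + f n

sum-upTo : ∀ (f : ℕ → ℕ) n → sum (map f (upTo n)) ≡ ∑ n f
sum-upTo f zero    = refl
sum-upTo f (suc n) = begin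
  sum (map f (upTo (suc n)))               ≡⟨ cong (sum ∘ map f) (upTo-∷ʳ n) ⟨
  sum (map f (upTo n ++ n ∷ []))           ≡⟨ cong sum (map-++ f (upTo n) (n ∷ [])) ⟩
  sum (map f (upTo n) ++ f n ∷ [])         ≡⟨ sum-++ (map f (upTo n)) (f n ∷ []) ⟩
  sum (map f (upTo n)) + (f n + 0)         ≡⟨ cong₂ _+_ (sum-upTo f n) (+-identityʳ (f n)) ⟩
  ∑ n f + f n                              ∎
  where open ≡-Reasoning

∑-cong : ∀ n {f g} → (∀ i → i < n → f i ≡ g i) → ∑ n f ≡ ∑ n g
∑-cong zero    e = refl
∑-cong (suc n) e = cong₂ _+_ (∑-cong n (λ i i<n → e i (m<n⇒m<1+n i<n))) (e n (n<1+n n))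

-- All four terms obey the same recursion, so only `i = 0` has content: there `R (suc m) 0` vanishes
-- and the claim becomes the instance `m`, `1`, `φ ∘ suc`. For the weight `one` this is the identity
-- 1 + ρ = 2𝒜 multiplied by ρ^i.
R-F : ∀ m i φ → R m i φ + R m (suc i) (φ ∘ suc) ≡ F m i φ + F m i (φ ∘ suc)
R-F zero    i       φ = refl
R-F (suc m) zero    φ = trans (+-comm (R m 2 (φ ∘ suc ∘ suc)) _) (R-F m 1 (φ ∘ suc))
R-F (suc m) (suc i) φ = trans
  (lem (R (suc m) i φ) (R (suc m) (suc i) (φ ∘ suc)) (R m (suc (suc i)) (φ ∘ suc)) (R m (suc i) φ) _ _)
  (trans (cong₂ _+_ (cong₂ _+_ (R-F (suc m) i φ) (R-F m (suc (suc i)) (φ ∘ suc))) (R-F m (suc i) φ))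
  (sym (lem (F (suc m) i φ) (F (suc m) i (φ ∘ suc)) (F m (suc (suc i)) (φ ∘ suc)) (F m (suc i) φ) _ _)))
  where
  lem : ∀ a b c d e f → (a + c + d) + (b + e + f) ≡ (a + b) + (c + e) + (d + f)
  lem = ℕ-Solver.solve-∀

-- The child sum of a 213-avoiding permutation with initial run `i`: the maximum placed at the end
-- of the run creates no descent, each of the `i` earlier places creates one, and a descent stands
-- for two chains. Unrolling the recursion in `i` and moving the `φ ∘ suc` terms by one index gives
-- it.
F-run-step : ∀ m i φ → F (suc m) i φ ≡ F m (suc i) (φ ∘ suc) + ∑ i (λ j → F m (suc j) (λ k → φ k + φ (suc k)))
F-run-step m zero    φ = sym (+-identityʳ _)
F-run-step m (suc i) φ = trans
  (cong (λ t → t + F m (suc (suc i)) (φ ∘ suc) + F m (suc i) φ) (F-run-step m i φ))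
  (trans (lem (F m (suc i) (φ ∘ suc)) _ _ _)
  (cong (λ t → F m (suc (suc i)) (φ ∘ suc) + (∑ i (λ j → F m (suc j) (λ k → φ k + φ (suc k))) + t))
    (sym (F-+ m (suc i) φ (φ ∘ suc)))))
  where
  lem : ∀ a b c d → a + b + c + d ≡ c + (b + (d + a))
  lem = ℕ-Solver.solve-∀

-- The child sum of an unbounded chain with `k` blocks: a new lowest block keeps it unbounded, every
-- other insertion ends a weak ascent and continues in `R`. `R-F` trades the extra `F` terms for `R`
-- terms.
F-chain-step : ∀ m k φ → F (suc m) k φ ≡
  F m (suc k) (φ ∘ suc) + ∑ k (λ b → R m (suc (suc b)) (φ ∘ suc)) + ∑ k (λ b → R m (suc b) φ)
F-chain-step m zero    φ = sym (trans (+-identityʳ _) (+-identityʳ _))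
F-chain-step m (suc k) φ = begin
  F (suc m) k φ + f₂ + f₁
    ≡⟨ cong (λ t → t + f₂ + f₁) (F-chain-step m k φ) ⟩
  (f₁′ + s₂ + s₁) + f₂ + f₁
    ≡⟨ lem₁ f₁′ s₂ s₁ f₂ f₁ ⟩
  (f₁ + f₁′) + f₂ + (s₂ + s₁)
    ≡⟨ cong (λ t → t + f₂ + (s₂ + s₁)) (R-F m (suc k) φ) ⟨
  (R m (suc k) φ + R m (suc (suc k)) (φ ∘ suc)) + f₂ + (s₂ + s₁)
    ≡⟨ lem₂ (R m (suc k) φ) (R m (suc (suc k)) (φ ∘ suc)) f₂ s₂ s₁ ⟩
  f₂ + (s₂ + R m (suc (suc k)) (φ ∘ suc)) + (s₁ + R m (suc k) φ) ∎
  where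
  open ≡-Reasoning
  f₁ f₁′ f₂ s₁ s₂ : ℕ
  f₁ = F m (suc k) φ
  f₁′ = F m (suc k) (φ ∘ suc)
  f₂ = F m (suc (suc k)) (φ ∘ suc)
  s₂ = ∑ k (λ b → R m (suc (suc b)) (φ ∘ suc))
  s₁ = ∑ k (λ b → R m (suc b) φ)
  lem₁ : ∀ a b c d e → a + b + c + d + e ≡ (e + a) + d + (b + c)
  lem₁ = ℕ-Solver.solve-∀
  lem₂ : ∀ a b c d e → (a + b) + c + (d + e) ≡ c + (d + b) + (e + a)
  lem₂ = ℕ-Solver.solve-∀

-- The child sum of a chain with bound `M`. The index of `R` is `suc M`, the number of blocks that
-- the next element may still join.
R-chain-step : ∀ m M φ → R (suc m) (suc M) φ ≡
  R m (suc (suc M)) (φ ∘ suc) + ∑ M (λ b → R m (suc (suc b)) (φ ∘ suc)) + ∑ (suc M) (λ b → R m (suc b) φ)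
R-chain-step m zero    φ = cong (_+ R m 1 φ) (sym (+-identityʳ _))
R-chain-step m (suc M) φ = trans
  (cong (λ t → t + R m (suc (suc (suc M))) (φ ∘ suc) + R m (suc (suc M)) φ) (R-chain-step m M φ))
  (lem (R m (suc (suc M)) (φ ∘ suc)) _ _ _ _)
  where
  lem : ∀ a b c d e → a + b + c + d + e ≡ d + (b + a) + (c + e)
  lem = ℕ-Solver.solve-∀

-- Weighted sums over lists and enumerations without repetition

total : {A : Set} → (A → ℕ) → List A → ℕ
total f xs = sum (map f xs)

module _ {A : Set} where

  total-++ : ∀ (f : A → ℕ) xs ys → total f (xs ++ ys) ≡ total f xs + total f ys
  total-++ f xs ys = trans (cong sum (map-++ f xs ys)) (sum-++ (map f xs) (map f ys))

  total-map : ∀ {B : Set} (f : A → ℕ) (g : B → A) xs → total f (map g xs) ≡ total (f ∘ g) xs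
  total-map f g xs = cong sum (sym (map-∘ xs))

  total-concatMap : ∀ {B : Set} (f : A → ℕ) (g : B → List A) xs → total f (concatMap g xs) ≡ total (λ x → total f (g x)) xs
  total-concatMap f g []       = refl
  total-concatMap f g (x ∷ xs) = trans (total-++ f (g x) (concatMap g xs)) (cong (total f (g x) +_) (total-concatMap f g xs))

  total-cong : ∀ {f g : A → ℕ} xs → (∀ {x} → x ∈ xs → f x ≡ g x) → total f xs ≡ total g xs
  total-cong []       e = refl
  total-cong (x ∷ xs) e = cong₂ _+_ (e (here refl)) (total-cong xs (e ∘ there))

  total-zero : ∀ {f : A → ℕ} xs → (∀ {x} → x ∈ xs → f x ≡ 0) → total f xs ≡ 0
  total-zero []       e = refl
  total-zero (x ∷ xs) e = cong₂ _+_ (e (here refl)) (total-zero xs (e ∘ there))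

  total-↭ : ∀ (f : A → ℕ) {xs ys} → xs ↭ ys → total f xs ≡ total f ys
  total-↭ f p = sum-↭ (Perm.map⁺ f p)

  total-+ : ∀ (f g : A → ℕ) xs → total (λ x → f x + g x) xs ≡ total f xs + total g xs
  total-+ f g []       = refl
  total-+ f g (x ∷ xs) = trans (cong (f x + g x +_) (total-+ f g xs)) (+-interchange (f x) (g x) _ _)
    where
    open import Algebra.Properties.CommutativeSemigroup +-commutativeSemigroup using () renaming
        (interchange to +-interchange)

𝟙 : Bool → ℕ
𝟙 true  = 1
𝟙 false = 0

count-total : ∀ {A : Set} (p : A → Bool) xs → count p xs ≡ total (𝟙 ∘ p) xs
count-total p []       = refl
count-total p (x ∷ xs) with p x
... | true  = cong suc (count-total p xs)
... | false = count-total p xs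

enumerations-↭ : ∀ {A : Set} {xs ys : List A} → Unique xs → Unique ys →
  (∀ {x} → x ∈ xs → x ∈ ys) → (∀ {x} → x ∈ ys → x ∈ xs) → xs ↭ ys
enumerations-↭ u v p q = ∼bag⇒↭ (unique∧set⇒bag u v (mk⇔ p q))

∈-concatMap : ∀ {A B : Set} (g : A → List B) {x y xs} → x ∈ xs → y ∈ g x → y ∈ concatMap g xs
∈-concatMap g p q = ∈-concatMap⁺ g (lose p q)

∈-concatMap⁻¹ : ∀ {A B : Set} (g : A → List B) {y} xs → y ∈ concatMap g xs → ∃[ x ] x ∈ xs × y ∈ g x
∈-concatMap⁻¹ g xs p = find (∈-concatMap⁻ g p)

-- `back` recovers the parent of an element, so the families of different parents are disjoint. It
-- is instantiated with the head of a list, with `restrict` and with `deleteMax`.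
concatMap-unique : ∀ {A B : Set} (g : A → List B) (back : B → A) {xs} → Unique xs →
  (∀ {x} → x ∈ xs → Unique (g x)) → (∀ {x y} → x ∈ xs → y ∈ g x → back y ≡ x) → Unique (concatMap g xs)
concatMap-unique g back {[]}     []      ug eq = []
concatMap-unique g back {x ∷ xs} (x∉ ∷ u) ug eq = Uniq.++⁺ (ug (here refl))
  (concatMap-unique g back u (ug ∘ there) (eq ∘ there)) λ { (p , q) → disjoint p q }
  where
  disjoint : ∀ {y} → y ∈ g x → ¬ (y ∈ concatMap g xs)
  disjoint p q with ∈-concatMap⁻¹ g xs q
  ... | x′ , i , q′ = All.lookup x∉ i (trans (sym (eq (here refl) p)) (eq (there i) q′))

∈-filterᵇ⁺ : ∀ {A : Set} (p : A → Bool) {x xs} → x ∈ xs → T (p x) → x ∈ filterᵇ p xs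
∈-filterᵇ⁺ p = ∈-filter⁺ (T? ∘ p)

∈-filterᵇ⁻ : ∀ {A : Set} (p : A → Bool) {x xs} → x ∈ filterᵇ p xs → x ∈ xs × T (p x)
∈-filterᵇ⁻ p = ∈-filter⁻ (T? ∘ p)

unique-⊆-length : ∀ {A : Set} {xs ys : List A} → Unique xs → (∀ {x} → x ∈ xs → x ∈ ys) → length xs ≤ length ys
unique-⊆-length {xs = []}     []       sub = z≤n
unique-⊆-length {xs = x ∷ xs} (x∉ ∷ u) sub with ∈-∃++ (sub (here refl))
... | ys₁ , ys₂ , refl = subst (suc (length xs) ≤_) (sym (len ys₁)) (s≤s (unique-⊆-length u sub′))
  where
  len : ∀ zs → length (zs ++ x ∷ ys₂) ≡ suc (length (zs ++ ys₂))
  len []       = refl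
  len (z ∷ zs) = cong suc (len zs)
  sub′ : ∀ {y} → y ∈ xs → y ∈ ys₁ ++ ys₂
  sub′ {y} i with ∈-++⁻ ys₁ (sub (there i))
  ... | inj₁ p           = ∈-++⁺ˡ p
  ... | inj₂ (here refl) = ⊥-elim (All.lookup x∉ i refl)
  ... | inj₂ (there p)   = ∈-++⁺ʳ ys₁ p

lists-unique : ∀ m k → Unique (lists m k)
lists-unique zero    k = [] ∷ []
lists-unique (suc m) k = concatMap-unique (λ v → map (v ∷_) (lists m k)) head′ (upTo⁺ k)
  (λ _ → Uniq.map⁺ (proj₂ ∘ ∷-injective) (lists-unique m k)) recover
  where
  head′ : List ℕ → ℕ
  head′ []      = 0
  head′ (v ∷ _) = v
  recover : ∀ {v y} → v ∈ upTo k → y ∈ map (v ∷_) (lists m k) → head′ y ≡ v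
  recover _ p with ∈-map⁻ _ p
  ... | _ , _ , refl = refl

∈-lists⁺ : ∀ {k} y → All (_< k) y → y ∈ lists (length y) k
∈-lists⁺ []       []       = here refl
∈-lists⁺ (v ∷ y) (v<k ∷ p) = ∈-concatMap _ (∈-upTo⁺ v<k) (∈-map⁺ (v ∷_) (∈-lists⁺ y p))

∈-lists⁻ : ∀ m k {y} → y ∈ lists m k → length y ≡ m × All (_< k) y
∈-lists⁻ zero    k (here refl) = refl , []
∈-lists⁻ (suc m) k p with ∈-concatMap⁻¹ _ (upTo k) p
... | v , v∈ , q with ∈-map⁻ _ q
... | y , y∈ , refl with ∈-lists⁻ m k y∈
... | refl , a = refl , ∈-upTo⁻ v∈ ∷ a

deduplicateᵇ-unique : ∀ xs → Unique (deduplicateᵇ _≡ᵇ_ xs)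
deduplicateᵇ-unique []       = []
deduplicateᵇ-unique (x ∷ xs) =
  All.map (λ {y} ne e → ne (≡⇒≡ᵇ x y e)) (Allₚ.all-filter (¬? ∘ T? ∘ (x ≡ᵇ_)) (deduplicateᵇ _≡ᵇ_ xs))
  ∷ Uniq.filter⁺ (¬? ∘ T? ∘ (x ≡ᵇ_)) (deduplicateᵇ-unique xs)

∈-deduplicateᵇ⁺ : ∀ {z} xs → z ∈ xs → z ∈ deduplicateᵇ _≡ᵇ_ xs
∈-deduplicateᵇ⁺ (x ∷ xs) (here refl) = here refl
∈-deduplicateᵇ⁺ {z} (x ∷ xs) (there p) with x ≟ z
... | yes refl = here refl
... | no x≢z   = there (∈-filter⁺ (¬? ∘ T? ∘ (x ≡ᵇ_)) (∈-deduplicateᵇ⁺ xs p) (x≢z ∘ ≡ᵇ⇒≡ x z))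

∈-deduplicateᵇ⁻ : ∀ {z} xs → z ∈ deduplicateᵇ _≡ᵇ_ xs → z ∈ xs
∈-deduplicateᵇ⁻ xs p = ∈-deduplicate⁻ (λ x y → T? (x ≡ᵇ y)) xs p

-- The insertion tree of weak-ordering chains

Ranks : ℕ → List ℕ → Set
Ranks k r = (∀ {v} → v ∈ r → v < k) × (∀ {v} → v < k → v ∈ r)

blocks : List ℕ → ℕ
blocks = foldr (λ v k → suc v ⊔ k) 0

∈⇒<blocks : ∀ {v} r → v ∈ r → v < blocks r
∈⇒<blocks (x ∷ r) (here refl) = m≤m⊔n (suc x) (blocks r)
∈⇒<blocks (x ∷ r) (there p)   = ≤-trans (∈⇒<blocks r p) (m≤n⊔m (suc x) (blocks r))

blocks-least : ∀ {k} r → (∀ {v} → v ∈ r → v < k) → blocks r ≤ k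
blocks-least []      lt = z≤n
blocks-least (x ∷ r) lt = ⊔-lub (lt (here refl)) (blocks-least r (lt ∘ there))

Ranks⇒blocks : ∀ {k r} → Ranks k r → blocks r ≡ k
Ranks⇒blocks {zero}  {r} (lt , mem) = n≤0⇒n≡0 (blocks-least r lt)
Ranks⇒blocks {suc k} {r} (lt , mem) = ≤-antisym (blocks-least r lt) (∈⇒<blocks r (mem (n<1+n k)))

IsChain : List ℕ → Set
IsChain r = Ranks (blocks r) r

Ranks⇒IsChain : ∀ {k r} → Ranks k r → IsChain r
Ranks⇒IsChain {r = r} p = subst (λ k → Ranks k r) (sym (Ranks⇒blocks p)) p

-- Pigeonhole. This is why the entries below `n` that `WOC n` draws from reach every chain on `n`
-- elements.
blocks≤length : ∀ {r} → IsChain r → blocks r ≤ length r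
blocks≤length {r} (_ , mem) = subst (_≤ length r) (length-upTo (blocks r))
  (unique-⊆-length (upTo⁺ (blocks r)) (mem ∘ ∈-upTo⁻))

<blocks⇒∃≥ : ∀ {v} r → v < blocks r → ∃[ u ] u ∈ r × v ≤ u
<blocks⇒∃≥ {v} (x ∷ r) lt with v ≤? x
... | yes v≤x = x , here refl , v≤x
... | no  v≰x with <blocks⇒∃≥ r (≰⇒> λ b≤v → <⇒≱ lt (⊔-lub (≰⇒> v≰x) b≤v))
... | u , i , le = u , there i , le

T⇒≡true : ∀ {b} → T b → b ≡ true
T⇒≡true {true} _ = refl

≡true⇒T : ∀ {b} → b ≡ true → T b
≡true⇒T refl = _

-- Validity is closure under predecessor, so everything below an occurring rank occurs by descending
-- from it.
validRanks⇒IsChain : ∀ r → T (validRanks r) → IsChain r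
validRanks⇒IsChain r val = ∈⇒<blocks r , λ lt → let u , u∈ , v≤u = <blocks⇒∃≥ r lt in down u∈ v≤u
  where
  pred∈ : ∀ {v} → suc v ∈ r → v ∈ r
  pred∈ {v} p with Equivalence.to (T-∨ {suc v ≡ᵇ 0}) (All.lookup (Allₚ.all⁺ _ r val) p)
  ... | inj₂ q with find (Anyₚ.any⁻ (λ u → u ≡ᵇ v) r q)
  ... | u , u∈ , e = subst (_∈ r) (≡ᵇ⇒≡ u v e) u∈
  down : ∀ {u v} → u ∈ r → v ≤ u → v ∈ r
  down {u} {v} p le with m≤n⇒m<n∨m≡n le
  ... | inj₂ refl = p
  down {suc u} p le | inj₁ lt = down (pred∈ p) (s≤s⁻¹ lt)

IsChain⇒validRanks : ∀ r → IsChain r → T (validRanks r)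
IsChain⇒validRanks r (lt , mem) = Allₚ.all⁻ _ (All.tabulate ok)
  where
  ok : ∀ {v} → v ∈ r → T ((v ≡ᵇ 0) ∨ any (λ u → u ≡ᵇ pred v) r)
  ok {zero}  p = _
  ok {suc v} p = Anyₚ.any⁺ _ (lose (mem (<-trans (n<1+n v) (lt p))) (≡⇒≡ᵇ v v refl))

∈-WOC⁺ : ∀ r → IsChain r → r ∈ WOC (length r)
∈-WOC⁺ r c = ∈-filterᵇ⁺ validRanks
  (∈-lists⁺ r (All.tabulate (λ p → ≤-trans (proj₁ c p) (blocks≤length c)))) (IsChain⇒validRanks r c)

∈-WOC⁻ : ∀ {n r} → r ∈ WOC n → length r ≡ n × IsChain r
∈-WOC⁻ {n} {r} p = let q , val = ∈-filterᵇ⁻ validRanks p in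
  proj₁ (∈-lists⁻ n n q) , validRanks⇒IsChain r val

-- Opening a new block at rank `b`: shifting the higher ranks, and undoing it

punch : ℕ → ℕ → ℕ
punch b v = if v <ᵇ b then v else suc v

unpunch : ℕ → ℕ → ℕ
unpunch b v = if v <ᵇ b then v else pred v

<ᵇ-true : ∀ {m n} → m < n → (m <ᵇ n) ≡ true
<ᵇ-true lt = T⇒≡true (<⇒<ᵇ lt)

<ᵇ-false : ∀ {m n} → n ≤ m → (m <ᵇ n) ≡ false
<ᵇ-false {m} {n} le with m <ᵇ n in eq
... | false = refl
... | true  = ⊥-elim (<⇒≱ (<ᵇ⇒< m n (≡true⇒T eq)) le)

punch-< : ∀ {b v} → v < b → punch b v ≡ v
punch-< lt rewrite <ᵇ-true lt = refl

punch-≥ : ∀ {b v} → b ≤ v → punch b v ≡ suc v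
punch-≥ le rewrite <ᵇ-false le = refl

unpunch-< : ∀ {b v} → v < b → unpunch b v ≡ v
unpunch-< lt rewrite <ᵇ-true lt = refl

unpunch-≥ : ∀ {b v} → b ≤ v → unpunch b v ≡ pred v
unpunch-≥ le rewrite <ᵇ-false le = refl

punch-mono-< : ∀ b {u v} → u < v → punch b u < punch b v
punch-mono-< b {u} {v} lt with <-≤-connex u b | <-≤-connex v b
... | inj₁ p | inj₁ q rewrite punch-< p | punch-< q = lt
... | inj₁ p | inj₂ q rewrite punch-< p | punch-≥ q = m<n⇒m<1+n lt
... | inj₂ p | inj₁ q = ⊥-elim (<⇒≱ (<-trans lt q) p)
... | inj₂ p | inj₂ q rewrite punch-≥ p | punch-≥ q = s<s lt

punch-mono-≤ : ∀ b {u v} → u ≤ v → punch b u ≤ punch b v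
punch-mono-≤ b le with m≤n⇒m<n∨m≡n le
... | inj₁ lt   = <⇒≤ (punch-mono-< b lt)
... | inj₂ refl = ≤-refl

punch≢ : ∀ b v → punch b v ≢ b
punch≢ b v e with <-≤-connex v b
... | inj₁ p = <⇒≢ p (trans (sym (punch-< p)) e)
... | inj₂ p = <⇒≢ (s≤s p) (sym (trans (sym (punch-≥ p)) e))

punch-unpunch : ∀ {b v} → v ≢ b → punch b (unpunch b v) ≡ v
punch-unpunch {b} {v} ne with <-≤-connex v b
... | inj₁ p = trans (cong (punch b) (unpunch-< p)) (punch-< p)
... | inj₂ p with ≤∧≢⇒< p (ne ∘ sym)
punch-unpunch {b} {suc v} ne | inj₂ p | lt = trans (cong (punch b) (unpunch-≥ p)) (punch-≥ (s≤s⁻¹ lt))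

unpunch-punch : ∀ b v → unpunch b (punch b v) ≡ v
unpunch-punch b v with <-≤-connex v b
... | inj₁ p = trans (cong (unpunch b) (punch-< p)) (unpunch-< p)
... | inj₂ p = trans (cong (unpunch b) (punch-≥ p)) (unpunch-≥ (m≤n⇒m≤1+n p))

punch≤suc : ∀ b v → punch b v ≤ suc v
punch≤suc b v with <-≤-connex v b
... | inj₁ p = subst (_≤ suc v) (sym (punch-< p)) (n≤1+n v)
... | inj₂ p = ≤-reflexive (punch-≥ p)

unpunch< : ∀ {b v k} → v ≢ b → b ≤ k → v < suc k → unpunch b v < k
unpunch< {b} {v} ne b≤k v≤k with <-≤-connex v b
... | inj₁ p = subst (_< _) (sym (unpunch-< p)) (≤-trans p b≤k)
... | inj₂ p with ≤∧≢⇒< p (ne ∘ sym)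
unpunch< {b} {suc v} ne b≤k v≤k | inj₂ p | lt = subst (_< _) (sym (unpunch-≥ p)) (s≤s⁻¹ v≤k)

insertBlock insertInto : List ℕ → ℕ → List ℕ
insertBlock r b = map (punch b) r ∷ʳ b
insertInto  r b = r ∷ʳ b

children : List ℕ → List (List ℕ)
children r = map (insertBlock r) (upTo (suc (blocks r))) ++ map (insertInto r) (upTo (blocks r))

chains : ℕ → List (List ℕ)
chains zero    = [] ∷ []
chains (suc n) = concatMap children (chains n)

∈-∷ʳ⁻ : ∀ {v : ℕ} r {z} → v ∈ r ∷ʳ z → v ∈ r ⊎ v ≡ z
∈-∷ʳ⁻ r p with ∈-++⁻ r p
... | inj₁ q        = inj₁ q
... | inj₂ (here e) = inj₂ e

insertBlock-Ranks : ∀ {k r b} → Ranks k r → b ≤ k → Ranks (suc k) (insertBlock r b)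
insertBlock-Ranks {k} {r} {b} (lt , mem) b≤k = lt′ , mem′
  where
  lt′ : ∀ {v} → v ∈ insertBlock r b → v < suc k
  lt′ p with ∈-∷ʳ⁻ (map (punch b) r) p
  ... | inj₂ refl = s≤s b≤k
  ... | inj₁ q with ∈-map⁻ (punch b) q
  ... | u , u∈ , refl = s≤s (≤-trans (punch≤suc b u) (lt u∈))
  mem′ : ∀ {v} → v < suc k → v ∈ insertBlock r b
  mem′ {v} v≤k with v ≟ b
  ... | yes refl = ∈-++⁺ʳ (map (punch b) r) (here refl)
  ... | no  ne   = ∈-++⁺ˡ (subst (_∈ map (punch b) r) (punch-unpunch ne) (∈-map⁺ (punch b) (mem (unpunch< ne b≤k v≤k))))

insertInto-Ranks : ∀ {k r b} → Ranks k r → b < k → Ranks k (insertInto r b)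
insertInto-Ranks {k} {r} {b} (lt , mem) b<k = lt′ , λ v<k → ∈-++⁺ˡ (mem v<k)
  where
  lt′ : ∀ {v} → v ∈ insertInto r b → v < k
  lt′ p with ∈-∷ʳ⁻ r p
  ... | inj₁ q    = lt q
  ... | inj₂ refl = b<k

data Child (r : List ℕ) : List ℕ → Set where
  block : ∀ {b} → b ≤ blocks r → Child r (insertBlock r b)
  into  : ∀ {b} → b < blocks r → Child r (insertInto r b)

∈-children⁻ : ∀ r {c} → c ∈ children r → Child r c
∈-children⁻ r p with ∈-++⁻ (map (insertBlock r) (upTo (suc (blocks r)))) p
... | inj₁ q with ∈-map⁻ (insertBlock r) q
...   | b , b∈ , refl = block (s≤s⁻¹ (∈-upTo⁻ b∈))
∈-children⁻ r p | inj₂ q with ∈-map⁻ (insertInto r) q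
...   | b , b∈ , refl = into (∈-upTo⁻ b∈)

∈-children⁺ : ∀ {r c} → Child r c → c ∈ children r
∈-children⁺ {r} (block b≤k) = ∈-++⁺ˡ (∈-map⁺ (insertBlock r) (∈-upTo⁺ (s≤s b≤k)))
∈-children⁺ {r} (into b<k)  = ∈-++⁺ʳ (map (insertBlock r) (upTo (suc (blocks r)))) (∈-map⁺ (insertInto r) (∈-upTo⁺ b<k))

length-∷ʳ : ∀ (r : List ℕ) z → length (r ∷ʳ z) ≡ suc (length r)
length-∷ʳ r z = trans (length-++ r) (+-comm (length r) 1)

∈-chains⁻ : ∀ n {r} → r ∈ chains n → length r ≡ n × IsChain r
∈-chains⁻ zero    (here refl) = refl , (λ ()) , (λ ())
∈-chains⁻ (suc n) p with ∈-concatMap⁻¹ children (chains n) p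
... | r , r∈ , q with ∈-chains⁻ n r∈ | ∈-children⁻ r q
... | refl , c | block {b} b≤k = trans (length-∷ʳ (map (punch b) r) b) (cong suc (length-map (punch b) r))
                           , Ranks⇒IsChain (insertBlock-Ranks c b≤k)
... | refl , c | into {b} b<k  = length-∷ʳ r b , Ranks⇒IsChain (insertInto-Ranks c b<k)

-- The last entry decides how the chain arose: if its rank occurs earlier it joined a block;
-- otherwise it opened one, and closing the gap with `unpunch` gives the parent.
∈-chains⁺ : ∀ n {r} → length r ≡ n → IsChain r → r ∈ chains n
∈-chains⁺ zero    {[]} refl _ = here refl
∈-chains⁺ (suc n) {c} len ch with initLast c
∈-chains⁺ (suc n) {.(u ∷ʳ z)} len ch | u ∷ʳ′ z with z ∈? u
... | yes z∈u = ∈-concatMap children (∈-chains⁺ n len′ (Ranks⇒IsChain rk))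
  (∈-children⁺ (into (subst (z <_) (sym (Ranks⇒blocks rk)) (proj₁ rk z∈u))))
  where
  len′ : length u ≡ n
  len′ = suc-injective (trans (sym (length-∷ʳ u z)) len)
  mem′ : ∀ {v} → v < blocks (u ∷ʳ z) → v ∈ u
  mem′ lt with ∈-∷ʳ⁻ u (proj₂ ch lt)
  ... | inj₁ p    = p
  ... | inj₂ refl = z∈u
  rk : Ranks (blocks (u ∷ʳ z)) u
  rk = proj₁ ch ∘ ∈-++⁺ˡ , mem′
... | no  z∉u = subst (_∈ chains (suc n)) (cong (_∷ʳ z) punched)
  (∈-concatMap children (∈-chains⁺ n len′ (Ranks⇒IsChain rk))
    (∈-children⁺ (block (subst (z ≤_) (sym (Ranks⇒blocks rk)) z≤k))))
  where
  r : List ℕ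
  r = map (unpunch z) u
  punched : map (punch z) r ≡ u
  punched = trans (sym (map-∘ u)) (map-id-local (All.tabulate λ {v} v∈ → punch-unpunch {z} {v} λ { refl → z∉u v∈ }))
  len′ : length r ≡ n
  len′ = trans (length-map (unpunch z) u) (suc-injective (trans (sym (length-∷ʳ u z)) len))
  k : ℕ
  k = pred (blocks (u ∷ʳ z))
  z<K : z < blocks (u ∷ʳ z)
  z<K = proj₁ ch (∈-++⁺ʳ u (here refl))
  K≡ : suc k ≡ blocks (u ∷ʳ z)
  K≡ = suc-pred (blocks (u ∷ʳ z)) {{>-nonZero (≤-<-trans z≤n z<K)}}
  z≤k : z ≤ k
  z≤k = s≤s⁻¹ (subst (z <_) (sym K≡) z<K)
  lt′ : ∀ {v} → v ∈ r → v < k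
  lt′ p with ∈-map⁻ (unpunch z) p
  ... | w , w∈ , refl = unpunch< (λ { refl → z∉u w∈ }) z≤k (subst (w <_) (sym K≡) (proj₁ ch (∈-++⁺ˡ w∈)))
  mem′ : ∀ {v} → v < k → v ∈ r
  mem′ {v} lt with ∈-∷ʳ⁻ u (proj₂ ch (subst (punch z v <_) K≡ (s≤s (≤-trans (punch≤suc z v) lt))))
  ... | inj₁ p = subst (_∈ r) (unpunch-punch z v) (∈-map⁺ (unpunch z) p)
  ... | inj₂ e = ⊥-elim (punch≢ z v e)
  rk : Ranks k r
  rk = lt′ , mem′

-- The distinct values of `map f r` below `f v` are the images of 0, ..., v - 1, because no rank
-- below `v` is missing. The uses are `f = punch b` and `f = id`, the two ways in which a parent
-- sits inside its child.
standardize-map : ∀ {k} r f → (∀ {u v} → u < v → f u < f v) → Ranks k r → standardize (map f r) ≡ r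
standardize-map r f mono (lt , mem) = trans (sym (map-∘ r)) (map-id-local (All.tabulate ok))
  where
  below : ℕ → List ℕ
  below v = filterᵇ (λ u → u <ᵇ f v) (map f r)
  f-injective : ∀ {u v} → f u ≡ f v → u ≡ v
  f-injective {u} {v} e with <-cmp u v
  ... | tri< l _ _ = ⊥-elim (<⇒≢ (mono l) e)
  ... | tri≈ _ e′ _ = e′
  ... | tri> _ _ g = ⊥-elim (<⇒≢ (mono g) (sym e))
  ok : ∀ {v} → v ∈ r → length (deduplicateᵇ _≡ᵇ_ (below v)) ≡ v
  ok {v} v∈ = trans (↭-length (enumerations-↭ (deduplicateᵇ-unique (below v)) (Uniq.map⁺ f-injective (upTo⁺ v)) to from))
    (trans (length-map f (upTo v)) (length-upTo v))
    where
    to : ∀ {x} → x ∈ deduplicateᵇ _≡ᵇ_ (below v) → x ∈ map f (upTo v)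
    to p with ∈-filterᵇ⁻ (λ u → u <ᵇ f v) {xs = map f r} (∈-deduplicateᵇ⁻ (below v) p)
    ... | q , l with ∈-map⁻ f q
    ... | u , u∈ , refl = ∈-map⁺ f (∈-upTo⁺ (≰⇒> λ v≤u → <⇒≱ (<ᵇ⇒< (f u) (f v) l) (mono-≤ v≤u)))
      where
      mono-≤ : ∀ {u v} → u ≤ v → f u ≤ f v
      mono-≤ le with m≤n⇒m<n∨m≡n le
      ... | inj₁ l    = <⇒≤ (mono l)
      ... | inj₂ refl = ≤-refl
    from : ∀ {x} → x ∈ map f (upTo v) → x ∈ deduplicateᵇ _≡ᵇ_ (below v)
    from p with ∈-map⁻ f p
    ... | u , u∈ , refl = ∈-deduplicateᵇ⁺ (below v) (∈-filterᵇ⁺ (λ u → u <ᵇ f v)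
      (∈-map⁺ f (mem (<-trans (∈-upTo⁻ u∈) (lt v∈)))) (<⇒<ᵇ (mono (∈-upTo⁻ u∈))))

take-∷ʳ : ∀ (r : List ℕ) z → take (length (r ∷ʳ z) ∸ 1) (r ∷ʳ z) ≡ r
take-∷ʳ r z = trans (cong (λ n → take (n ∸ 1) (r ∷ʳ z)) (length-∷ʳ r z)) (go r)
  where
  go : ∀ r → take (length r) (r ∷ʳ z) ≡ r
  go []      = refl
  go (x ∷ r) = cong (x ∷_) (go r)

restrict-child : ∀ {r c} → IsChain r → Child r c → restrict c ≡ r
restrict-child {r} ch (block {b} _) = trans (cong standardize (take-∷ʳ (map (punch b) r) b))
    (standardize-map r (punch b) (punch-mono-< b) ch)
restrict-child {r} ch (into {b} _)  = trans (cong standardize (take-∷ʳ r b))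
    (trans (cong standardize (sym (map-id r))) (standardize-map r id id ch))

-- The two kinds of children are told apart by whether the last rank has occurred before: `punch b`
-- never takes the value `b`, whereas a joined block is already present.
children-unique : ∀ {r} → IsChain r → Unique (children r)
children-unique {r} (lt , mem) = Uniq.++⁺
  (Uniq.map⁺ (λ {b} {b′} → ∷ʳ-injectiveʳ (map (punch b) r) (map (punch b′) r)) (upTo⁺ (suc (blocks r))))
  (Uniq.map⁺ (∷ʳ-injectiveʳ r r) (upTo⁺ (blocks r)))
  λ { (p , q) → disjoint p q }
  where
  disjoint : ∀ {c} → c ∈ map (insertBlock r) (upTo (suc (blocks r))) → ¬ (c ∈ map (insertInto r) (upTo (blocks r)))
  disjoint p q with ∈-map⁻ (insertBlock r) p | ∈-map⁻ (insertInto r) q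
  ... | b , _ , refl | b′ , b′∈ , e with ∷ʳ-injective (map (punch b) r) r e
  ... | e₁ , refl with ∈-map⁻ (punch b) (subst (b ∈_) (sym e₁) (mem (∈-upTo⁻ b′∈)))
  ... | v , _ , e₂ = punch≢ b v (sym e₂)

chains-unique : ∀ n → Unique (chains n)
chains-unique zero    = [] ∷ []
chains-unique (suc n) = concatMap-unique children restrict (chains-unique n)
  (children-unique ∘ proj₂ ∘ ∈-chains⁻ n)
  (λ {r} r∈ c∈ → restrict-child (proj₂ (∈-chains⁻ n r∈)) (∈-children⁻ r c∈))

WOC↭chains : ∀ n → WOC n ↭ chains n
WOC↭chains n = enumerations-↭ (Uniq.filter⁺ _ (lists-unique n n)) (chains-unique n)
  (λ p → let len , c = ∈-WOC⁻ p in ∈-chains⁺ n len c)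
  (λ {r} p → let len , c = ∈-chains⁻ n p in subst (λ m → r ∈ WOC m) len (∈-WOC⁺ r c))

-- The stopping condition along the insertion tree

any-∷ʳ : ∀ {A : Set} (p : A → Bool) xs y → any p (xs ∷ʳ y) ≡ any p xs ∨ p y
any-∷ʳ p []       y = ∨-identityʳ (p y)
any-∷ʳ p (x ∷ xs) y = trans (cong (p x ∨_) (any-∷ʳ p xs y)) (sym (∨-assoc (p x) _ _))

any-upTo-suc : ∀ p n → any p (upTo (suc n)) ≡ any p (upTo n) ∨ p n
any-upTo-suc p n = trans (cong (any p) (sym (upTo-∷ʳ n))) (any-∷ʳ p (upTo n) n)

any-upTo-cong : ∀ n {p q} → (∀ {i} → i < n → p i ≡ q i) → any p (upTo n) ≡ any q (upTo n)
any-upTo-cong zero    e = refl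
any-upTo-cong (suc n) {p} {q} e = trans (any-upTo-suc p n)
  (trans (cong₂ _∨_ (any-upTo-cong n (e ∘ m<n⇒m<1+n)) (e (n<1+n n))) (sym (any-upTo-suc q n)))

any-upTo-∧ : ∀ n p c → any (λ i → p i ∧ c) (upTo n) ≡ any p (upTo n) ∧ c
any-upTo-∧ zero    p c = refl
any-upTo-∧ (suc n) p c = trans (any-upTo-suc (λ i → p i ∧ c) n)
  (trans (cong (_∨ (p n ∧ c)) (any-upTo-∧ n p c))
  (trans (sym (∧-distribʳ-∨ c (any p (upTo n)) (p n))) (cong (_∧ c) (sym (any-upTo-suc p n)))))

any-upTo-true : ∀ n p i → i < n → p i ≡ true → any p (upTo n) ≡ true
any-upTo-true (suc n) p i i<n e with m≤n⇒m<n∨m≡n (s≤s⁻¹ i<n)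
... | inj₁ lt   = trans (any-upTo-suc p n) (cong (_∨ p n) (any-upTo-true n p i lt e))
... | inj₂ refl = trans (any-upTo-suc p n) (trans (cong (any p (upTo n) ∨_) e) (∨-zeroʳ _))

any-upTo-false : ∀ n p → (∀ i → i < n → p i ≡ false) → any p (upTo n) ≡ false
any-upTo-false zero    p e = refl
any-upTo-false (suc n) p e = trans (any-upTo-suc p n)
  (cong₂ _∨_ (any-upTo-false n p (λ i lt → e i (m<n⇒m<1+n lt))) (e n (n<1+n n)))

at-∷ʳ-< : ∀ r z {i} → i < length r → at (r ∷ʳ z) i ≡ at r i
at-∷ʳ-< (x ∷ r) z {zero}  lt = refl
at-∷ʳ-< (x ∷ r) z {suc i} lt = at-∷ʳ-< r z (s≤s⁻¹ lt)

at-∷ʳ-last : ∀ r z → at (r ∷ʳ z) (length r) ≡ z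
at-∷ʳ-last []      z = refl
at-∷ʳ-last (x ∷ r) z = at-∷ʳ-last r z

at-map : ∀ (f : ℕ → ℕ) r {i} → i < length r → at (map f r) i ≡ f (at r i)
at-map f (x ∷ r) {zero}  lt = refl
at-map f (x ∷ r) {suc i} lt = at-map f r (s≤s⁻¹ lt)

∈⇒at : ∀ {v} r → v ∈ r → ∃[ i ] i < length r × at r i ≡ v
∈⇒at (x ∷ r) (here refl) = 0 , z<s , refl
∈⇒at (x ∷ r) (there p) with ∈⇒at r p
... | i , lt , e = suc i , s<s lt , e

completes : List ℕ → ℕ → Bool
completes r z = any (λ j → any (λ i → (at r i ≤ᵇ at r j) ∧ (at r j <ᵇ z)) (upTo j)) (upTo (length r))

hasBelow : List ℕ → ℕ → Bool
hasBelow r b = any (λ i → at r i ≤ᵇ b) (upTo (length r))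

containsStop-∷ʳ : ∀ r z → containsStop (r ∷ʳ z) ≡ containsStop r ∨ completes r z
containsStop-∷ʳ r z rewrite length-∷ʳ r z = trans (any-upTo-suc _ (length r)) (cong₂ _∨_
  (any-upTo-cong (length r) λ k< → any-upTo-cong _ λ j< → any-upTo-cong _ λ i< →
    cong₂ _∧_ (cong₂ _≤ᵇ_ (at-∷ʳ-< r z (<-trans i< (<-trans j< k<))) (at-∷ʳ-< r z (<-trans j< k<)))
              (cong₂ _<ᵇ_ (at-∷ʳ-< r z (<-trans j< k<)) (at-∷ʳ-< r z k<)))
  (any-upTo-cong (length r) λ j< → any-upTo-cong _ λ i< →
    cong₂ _∧_ (cong₂ _≤ᵇ_ (at-∷ʳ-< r z (<-trans i< j<)) (at-∷ʳ-< r z j<))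
              (cong₂ _<ᵇ_ (at-∷ʳ-< r z j<) (at-∷ʳ-last r z))))

completes-∷ʳ : ∀ r b z → completes (r ∷ʳ b) z ≡ completes r z ∨ (hasBelow r b ∧ (b <ᵇ z))
completes-∷ʳ r b z rewrite length-∷ʳ r b = trans (any-upTo-suc _ (length r)) (cong₂ _∨_
  (any-upTo-cong (length r) λ j< → any-upTo-cong _ λ i< →
    cong₂ _∧_ (cong₂ _≤ᵇ_ (at-∷ʳ-< r b (<-trans i< j<)) (at-∷ʳ-< r b j<)) (cong (_<ᵇ z) (at-∷ʳ-< r b j<)))
  (trans (any-upTo-cong (length r) (λ i< →
    cong₂ _∧_ (cong₂ _≤ᵇ_ (at-∷ʳ-< r b i<) (at-∷ʳ-last r b)) (cong (_<ᵇ z) (at-∷ʳ-last r b))))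
  (any-upTo-∧ (length r) (λ i → at r i ≤ᵇ b) (b <ᵇ z))))

≤ᵇ-true : ∀ {m n} → m ≤ n → (m ≤ᵇ n) ≡ true
≤ᵇ-true le = T⇒≡true (≤⇒≤ᵇ le)

≤ᵇ-false : ∀ {m n} → n < m → (m ≤ᵇ n) ≡ false
≤ᵇ-false {suc m} lt = <ᵇ-false {m} (s≤s⁻¹ lt)

punch-≤ᵇ : ∀ b u v → (punch b u ≤ᵇ punch b v) ≡ (u ≤ᵇ v)
punch-≤ᵇ b u v with <-≤-connex v u
... | inj₁ p = trans (≤ᵇ-false (punch-mono-< b p)) (sym (≤ᵇ-false p))
... | inj₂ p = trans (≤ᵇ-true (punch-mono-≤ b p)) (sym (≤ᵇ-true p))

punch-<ᵇ : ∀ b u v → (punch b u <ᵇ punch b v) ≡ (u <ᵇ v)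
punch-<ᵇ b u v with <-≤-connex u v
... | inj₁ p = trans (<ᵇ-true (punch-mono-< b p)) (sym (<ᵇ-true p))
... | inj₂ p = trans (<ᵇ-false (punch-mono-≤ b p)) (sym (<ᵇ-false p))

containsStop-punch : ∀ b r → containsStop (map (punch b) r) ≡ containsStop r
containsStop-punch b r rewrite length-map (punch b) r =
  any-upTo-cong (length r) λ k< → any-upTo-cong _ λ j< → any-upTo-cong _ λ i< →
    cong₂ _∧_ (trans (cong₂ _≤ᵇ_ (at-map (punch b) r (<-trans i< (<-trans j< k<))) (at-map (punch b) r (<-trans j< k<)))
        (punch-≤ᵇ b _ _))
              (trans (cong₂ _<ᵇ_ (at-map (punch b) r (<-trans j< k<)) (at-map (punch b) r k<)) (punch-<ᵇ b _ _))

completes-punch : ∀ b r z z′ → (∀ v → (punch b v <ᵇ z) ≡ (v <ᵇ z′)) → completes (map (punch b) r) z ≡ completes r z′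
completes-punch b r z z′ e rewrite length-map (punch b) r =
  any-upTo-cong (length r) λ j< → any-upTo-cong _ λ i< →
    cong₂ _∧_ (trans (cong₂ _≤ᵇ_ (at-map (punch b) r (<-trans i< j<)) (at-map (punch b) r j<)) (punch-≤ᵇ b _ _))
              (trans (cong (_<ᵇ z) (at-map (punch b) r j<)) (e _))

punch-threshold-≤ : ∀ b z → z ≤ b → ∀ v → (punch b v <ᵇ z) ≡ (v <ᵇ z)
punch-threshold-≤ b z z≤b v with <-≤-connex v b
... | inj₁ p = cong (_<ᵇ z) (punch-< p)
... | inj₂ p = trans (cong (_<ᵇ z) (punch-≥ p)) (trans (<ᵇ-false (≤-trans z≤b (m≤n⇒m≤1+n p)))
    (sym (<ᵇ-false (≤-trans z≤b p))))

punch-threshold-> : ∀ b z → b ≤ z → ∀ v → (punch b v <ᵇ suc z) ≡ (v <ᵇ z)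
punch-threshold-> b z b≤z v with <-≤-connex v b
... | inj₁ p = trans (cong (_<ᵇ suc z) (punch-< p)) (trans (<ᵇ-true (m<n⇒m<1+n (≤-trans p b≤z)))
    (sym (<ᵇ-true (≤-trans p b≤z))))
... | inj₂ p = cong (_<ᵇ suc z) (punch-≥ p)

-- An element of rank 0 precedes the new one, so whatever is appended ends a weak ascent. Opening a
-- block at positive rank does not disturb this.
hasBelow-chain : ∀ {k r} b → Ranks (suc k) r → hasBelow r b ≡ true
hasBelow-chain {k} {r} b (_ , mem) with ∈⇒at r (mem z<s)
... | i , lt , e = any-upTo-true (length r) (λ i → at r i ≤ᵇ b) i lt (cong (_≤ᵇ b) e)

hasBelow-punch : ∀ {k r} b → Ranks (suc k) r → hasBelow (map (punch (suc b)) r) (suc b) ≡ true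
hasBelow-punch {k} {r} b (_ , mem) with ∈⇒at (map (punch (suc b)) r) (∈-map⁺ (punch (suc b)) (mem z<s))
... | i , lt , e = any-upTo-true (length (map (punch (suc b)) r)) (λ i → at (map (punch (suc b)) r) i ≤ᵇ suc b) i lt
    (cong (_≤ᵇ suc b) e)

-- A new lowest block pushes every older rank above 0. It is the only insertion into a nonempty
-- chain that creates no weak ascent.
hasBelow-punch-zero : ∀ r → hasBelow (map (punch 0) r) 0 ≡ false
hasBelow-punch-zero r rewrite length-map (punch 0) r = any-upTo-false (length r) _
  (λ i lt → cong (_≤ᵇ 0) (at-map (punch 0) r lt))

-- Entries of rank at most M, and no others, can be appended without completing the stopping condition.
Cap : List ℕ → ℕ → ℕ → Set
Cap r k M = ∀ z → z ≤ k → completes r z ≡ (M <ᵇ z)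

-- Ranks from `b` on only move further up, so being below `b` can be tested before the shift.
containsStop-insertBlock : ∀ r b → containsStop (insertBlock r b) ≡ containsStop r ∨ completes r b
containsStop-insertBlock r b = trans (containsStop-∷ʳ (map (punch b) r) b)
  (cong₂ _∨_ (containsStop-punch b r) (completes-punch b r b b (punch-threshold-≤ b b ≤-refl)))

≤-∨-<ᵇ : ∀ b M z z′ → b ≤ M → (M < z′ → b < z) → (M <ᵇ z′) ∨ (b <ᵇ z) ≡ (b <ᵇ z)
≤-∨-<ᵇ b M z z′ le f with <-≤-connex M z′
... | inj₁ p rewrite <ᵇ-true p | <ᵇ-true (f p) = refl
... | inj₂ p rewrite <ᵇ-false p = refl

-- The new entry ends a weak ascent, and since `b ≤ M` it is now the smallest one to do so: the old
-- bound is absorbed.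
insertInto-Cap : ∀ {r k M b} → Ranks k r → Cap r k M → b ≤ M → b < k → Cap (insertInto r b) k b
insertInto-Cap {r} {suc k} {M} {b} rk cap b≤M b<k z z≤k = trans (completes-∷ʳ r b z)
  (trans (cong₂ (λ s t → s ∨ (t ∧ (b <ᵇ z))) (cap z z≤k) (hasBelow-chain b rk)) (≤-∨-<ᵇ b M z z b≤M (≤-<-trans b≤M)))

insertBlock-suc-Cap : ∀ {r k M b} → Ranks k r → Cap r k M → suc b ≤ M → suc b ≤ k → Cap (insertBlock r (suc b)) (suc k)
    (suc b)
insertBlock-suc-Cap {r} {suc k} {M} {b} rk cap b≤M b<k z z≤k = trans (completes-∷ʳ (map (punch (suc b)) r) (suc b) z)
  (trans (cong (λ t → completes (map (punch (suc b)) r) z ∨ (t ∧ (suc b <ᵇ z))) (hasBelow-punch b rk))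
      (main z z≤k (<-≤-connex (suc b) z)))
  where
  main : ∀ z → z ≤ suc (suc k) → (suc b < z ⊎ z ≤ suc b) → completes (map (punch (suc b)) r) z ∨ (suc b <ᵇ z) ≡ (suc b <ᵇ z)
  main z z≤k (inj₂ le) = trans
    (cong (_∨ (suc b <ᵇ z)) (trans (completes-punch (suc b) r z z (punch-threshold-≤ (suc b) z le))
        (cap z (≤-trans le b<k))))
    (≤-∨-<ᵇ (suc b) M z z b≤M (≤-<-trans b≤M))
  -- A test rank above the new block corresponds to the rank one lower before the shift.
  main (suc z) z≤k (inj₁ lt) = trans
    (cong (_∨ (suc b <ᵇ suc z)) (trans (completes-punch (suc b) r (suc z) z (punch-threshold-> (suc b) z (s≤s⁻¹ lt)))
        (cap z (s≤s⁻¹ z≤k))))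
    (≤-∨-<ᵇ (suc b) M (suc z) z b≤M (λ _ → lt))

insertBlock-zero-Cap : ∀ {r k M} → Cap r k M → Cap (insertBlock r 0) (suc k) (suc M)
insertBlock-zero-Cap {r} {k} {M} cap z z≤k = trans (completes-∷ʳ (map (punch 0) r) 0 z)
  (trans (cong (λ t → completes (map (punch 0) r) z ∨ (t ∧ (0 <ᵇ z))) (hasBelow-punch-zero r))
      (trans (∨-identityʳ _) (main z z≤k)))
  where
  main : ∀ z → z ≤ suc k → completes (map (punch 0) r) z ≡ (suc M <ᵇ z)
  main zero    z≤k = trans (completes-punch 0 r 0 0 (punch-threshold-≤ 0 0 z≤n)) (cap 0 z≤n)
  main (suc z) z≤k = trans (completes-punch 0 r (suc z) z (punch-threshold-> 0 z z≤n)) (cap z (s≤s⁻¹ z≤k))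

-- Weighted counts of avoiding descendants

live : (ℕ → ℕ) → List ℕ → ℕ
live φ r = if containsStop r then 0 else φ (blocks r)

-- Nodes containing the condition are expanded as well and weigh 0, so the sum runs over the full
-- tree; `descend-dead` shows that their subtrees contribute nothing.
descend : ℕ → (ℕ → ℕ) → List ℕ → ℕ
descend zero    φ r = live φ r
descend (suc m) φ r = total (descend m φ) (children r)

total-chains : ∀ m n φ → total (descend m φ) (chains n) ≡ total (live φ) (chains (m + n))
total-chains zero    n φ = refl
total-chains (suc m) n φ = trans (sym (total-concatMap (descend m φ) children (chains n)))
  (trans (total-chains m (suc n) φ) (cong (λ j → total (live φ) (chains j)) (+-suc m n)))

child-dead : ∀ {r c} → containsStop r ≡ true → Child r c → containsStop c ≡ true
child-dead {r} dead (block {b} _) = trans (containsStop-insertBlock r b) (cong (_∨ completes r b) dead)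
child-dead {r} dead (into {b} _)  = trans (containsStop-∷ʳ r b) (cong (_∨ completes r b) dead)

descend-dead : ∀ m φ {r} → containsStop r ≡ true → descend m φ r ≡ 0
descend-dead zero    φ dead rewrite dead = refl
descend-dead (suc m) φ {r} dead = total-zero (children r) (λ c∈ → descend-dead m φ (child-dead dead (∈-children⁻ r c∈)))

∑-suc : ∀ n f → ∑ (suc n) f ≡ f 0 + ∑ n (f ∘ suc)
∑-suc zero    f = sym (+-identityʳ (f 0))
∑-suc (suc n) f = trans (cong (_+ f (suc n)) (∑-suc n f)) (+-assoc (f 0) _ _)

∑-truncate : ∀ {n} N {f g} → n ≤ N → (∀ {i} → i < n → f i ≡ g i) → (∀ {i} → n ≤ i → i < N → f i ≡ 0) → ∑ N f ≡ ∑ n g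
∑-truncate {n} N le e z with m≤n⇒m<n∨m≡n le
... | inj₂ refl = ∑-cong N (λ i → e)
∑-truncate {n} (suc N) le e z | inj₁ lt = trans
  (cong₂ _+_ (∑-truncate N (s≤s⁻¹ lt) e (λ p q → z p (m<n⇒m<1+n q))) (z (s≤s⁻¹ lt) (n<1+n N))) (+-identityʳ _)

R-cong : ∀ m i {φ ψ} → (∀ k → φ k ≡ ψ k) → R m i φ ≡ R m i ψ
R-cong zero    i       e = e 0
R-cong (suc m) zero    e = refl
R-cong (suc m) (suc i) e = cong₂ _+_ (cong₂ _+_ (R-cong (suc m) i e) (R-cong m (suc (suc i)) (e ∘ suc))) (R-cong m (suc i) e)

-- The bound M of a node with k blocks is k itself when every insertion is allowed.
record Node (k M : ℕ) (r : List ℕ) : Set where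
  field
    ranks : Ranks k r
    cap   : Cap r k M
    alive : containsStop r ≡ false
open Node

module _ {k M r} (nd : Node k M r) where

  insertInto-dead : ∀ {b} → M < b → b < k → containsStop (insertInto r b) ≡ true
  insertInto-dead {b} M<b b<k = trans (containsStop-∷ʳ r b) (cong₂ _∨_ (alive nd) (trans (cap nd b (<⇒≤ b<k)) (<ᵇ-true M<b)))

  insertBlock-dead : ∀ {b} → M < b → b ≤ k → containsStop (insertBlock r b) ≡ true
  insertBlock-dead {b} M<b b≤k = trans (containsStop-insertBlock r b)
      (cong₂ _∨_ (alive nd) (trans (cap nd b b≤k) (<ᵇ-true M<b)))

  insertInto-Node : ∀ {b} → b ≤ M → b < k → Node k b (insertInto r b)
  insertInto-Node {b} b≤M b<k = record
    { ranks = insertInto-Ranks (ranks nd) b<k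
    ; cap   = insertInto-Cap (ranks nd) (cap nd) b≤M b<k
    ; alive = trans (containsStop-∷ʳ r b) (cong₂ _∨_ (alive nd) (trans (cap nd b (<⇒≤ b<k)) (<ᵇ-false b≤M))) }

  insertBlock-suc-Node : ∀ {b} → suc b ≤ M → suc b ≤ k → Node (suc k) (suc b) (insertBlock r (suc b))
  insertBlock-suc-Node {b} b≤M b≤k = record
    { ranks = insertBlock-Ranks (ranks nd) b≤k
    ; cap   = insertBlock-suc-Cap (ranks nd) (cap nd) b≤M b≤k
    ; alive = trans (containsStop-insertBlock r (suc b)) (cong₂ _∨_ (alive nd) (trans (cap nd (suc b) b≤k) (<ᵇ-false b≤M))) }

  insertBlock-zero-Node : Node (suc k) (suc M) (insertBlock r 0)
  insertBlock-zero-Node = record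
    { ranks = insertBlock-Ranks (ranks nd) z≤n
    ; cap   = insertBlock-zero-Cap {r} (cap nd)
    ; alive = trans (containsStop-insertBlock r 0) (cong₂ _∨_ (alive nd) (trans (cap nd 0 z≤n) (<ᵇ-false {M} z≤n))) }

  total-children : ∀ f → total f (children r) ≡
    f (insertBlock r 0) + ∑ k (λ b → f (insertBlock r (suc b))) + ∑ k (λ b → f (insertInto r b))
  total-children f rewrite Ranks⇒blocks (ranks nd) = trans
    (total-++ f (map (insertBlock r) (upTo (suc k))) (map (insertInto r) (upTo k)))
    (cong₂ _+_ (trans (total-map f (insertBlock r) (upTo (suc k)))
        (trans (sum-upTo (f ∘ insertBlock r) (suc k)) (∑-suc k (f ∘ insertBlock r))))
               (trans (total-map f (insertInto r) (upTo k)) (sum-upTo (f ∘ insertInto r) k)))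

  descend-zero : ∀ φ → descend 0 φ r ≡ φ (k + 0)
  descend-zero φ rewrite alive nd = cong φ (trans (Ranks⇒blocks (ranks nd)) (sym (+-identityʳ k)))

shift-+ : ∀ (φ : ℕ → ℕ) k j → φ (suc k + j) ≡ φ (k + suc j)
shift-+ φ k j = cong φ (sym (+-suc k j))

descend-capped : ∀ m φ {k M r} → Node k M r → M < k → descend m φ r ≡ R m (suc M) (λ j → φ (k + j))
descend-capped zero    φ nd M<k = descend-zero nd φ
descend-capped (suc m) φ {k} {M} {r} nd M<k = trans (total-children nd (descend m φ)) (trans
  (cong₂ _+_ (cong₂ _+_
    (trans (descend-capped m φ (insertBlock-zero-Node nd) (s<s M<k)) (R-cong m (suc (suc M)) (shift-+ φ k)))
    -- The bound cuts both sums: a block opened at rank `suc b` survives when `suc b ≤ M`, a block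
    -- joined at rank `b` when `b ≤ M`. Hence the lengths `M` and `suc M`.
    (∑-truncate k (<⇒≤ M<k)
      (λ {b} b<M → trans (descend-capped m φ (insertBlock-suc-Node nd b<M (≤-trans b<M (<⇒≤ M<k))) (s<s (<-trans b<M M<k)))
                         (R-cong m (suc (suc b)) (shift-+ φ k)))
      (λ M≤b b<k → descend-dead m φ (insertBlock-dead nd (s≤s M≤b) b<k))))
    (∑-truncate k M<k
      (λ b≤M → descend-capped m φ (insertInto-Node nd (s≤s⁻¹ b≤M) (≤-trans b≤M M<k)) (≤-trans b≤M M<k))
      (λ M<b b<k → descend-dead m φ (insertInto-dead nd M<b b<k))))
  (sym (R-chain-step m M (λ j → φ (k + j)))))

descend-uncapped : ∀ m φ {k r} → Node k k r → descend m φ r ≡ F m k (λ j → φ (k + j))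
descend-uncapped zero    φ nd = descend-zero nd φ
descend-uncapped (suc m) φ {k} {r} nd = trans (total-children nd (descend m φ)) (trans
  (cong₂ _+_ (cong₂ _+_
    (trans (descend-uncapped m φ (insertBlock-zero-Node nd)) (F-cong m (suc k) (shift-+ φ k)))
    (∑-cong k λ b b<k → trans (descend-capped m φ (insertBlock-suc-Node nd b<k b<k) (s<s b<k))
                              (R-cong m (suc (suc b)) (shift-+ φ k))))
    (∑-cong k λ b b<k → descend-capped m φ (insertInto-Node nd (<⇒≤ b<k) b<k) b<k))
  (sym (F-chain-step m k (λ j → φ (k + j)))))

-- The tree is started one level above x₁, at the empty chain, where no insertion is forbidden.
root-Node : Node 0 0 []
root-Node = record { ranks = (λ ()) , (λ ()) ; cap = λ { zero _ → refl } ; alive = refl }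

live-chains : ∀ n φ → total (live φ) (chains n) ≡ F n 0 φ
live-chains n φ = trans (cong (total (live φ) ∘ chains) (sym (+-identityʳ n)))
  (trans (sym (total-chains n 0 φ)) (trans (+-identityʳ _) (descend-uncapped n φ root-Node)))

avoiders-WOC : ∀ n → count (λ c → not (containsStop c)) (WOC n) ≡ F n 0 one
avoiders-WOC n = trans (count-total _ (WOC n)) (trans (total-↭ _ (WOC↭chains n))
  (trans (total-cong (chains n) (λ {r} _ → lem r)) (live-chains n one)))
  where
  lem : ∀ r → 𝟙 (not (containsStop r)) ≡ live one r
  lem r with containsStop r
  ... | true  = refl
  ... | false = refl

-- Leaves that contain the stopping condition

total-const : ∀ {A : Set} (c : ℕ) (xs : List A) → total (λ _ → c) xs ≡ length xs * c
total-const c []       = refl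
total-const c (x ∷ xs) = cong (c +_) (total-const c xs)

siblings : ℕ → ℕ
siblings k = suc k + k

-- The added `F (suc n) 0 one` counts the children that still avoid the condition. Together the two
-- terms count all children of avoiding chains, so it does not matter which of them complete the
-- condition.
stopping-leaves : ∀ n → count (λ c → containsStop c ∧ not (containsStop (restrict c))) (WOC (suc n))
  + F (suc n) 0 one ≡ F n 0 siblings
stopping-leaves n = begin
  count p (WOC (suc n)) + F (suc n) 0 one
    ≡⟨ cong₂ _+_ (count-total p (WOC (suc n))) (sym (live-chains (suc n) one)) ⟩
  total (𝟙 ∘ p) (WOC (suc n)) + total (live one) (chains (suc n))
    ≡⟨ cong (_+ total (live one) (chains (suc n))) (total-↭ (𝟙 ∘ p) (WOC↭chains (suc n))) ⟩
  total (𝟙 ∘ p) (chains (suc n)) + total (live one) (chains (suc n))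
    ≡⟨ total-+ (𝟙 ∘ p) (live one) (chains (suc n)) ⟨
  total q (chains (suc n))
    ≡⟨ total-concatMap q children (chains n) ⟩
  total (λ r → total q (children r)) (chains n)
    ≡⟨ total-cong (chains n) (λ r∈ → family (proj₂ (∈-chains⁻ n r∈))) ⟩
  total (live siblings) (chains n)
    ≡⟨ live-chains n siblings ⟩
  F n 0 siblings ∎
  where
  open ≡-Reasoning
  p : List ℕ → Bool
  p c = containsStop c ∧ not (containsStop (restrict c))
  q : List ℕ → ℕ
  q c = 𝟙 (p c) + live one c
  q-child : ∀ {r c} → IsChain r → Child r c → q c ≡ 𝟙 (not (containsStop r))
  q-child {r} {c} ch cc rewrite restrict-child ch cc with containsStop r in eq
  ... | true rewrite child-dead eq cc = refl
  ... | false with containsStop c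
  ...   | true  = refl
  ...   | false = refl
  length-children : ∀ r → length (children r) ≡ siblings (blocks r)
  length-children r = trans (length-++ (map (insertBlock r) (upTo (suc (blocks r)))))
    (cong₂ _+_ (trans (length-map (insertBlock r) (upTo (suc (blocks r)))) (length-upTo (suc (blocks r))))
               (trans (length-map (insertInto r) (upTo (blocks r))) (length-upTo (blocks r))))
  family : ∀ {r} → IsChain r → total q (children r) ≡ live siblings r
  family {r} ch = trans (total-cong (children r) (λ c∈ → q-child ch (∈-children⁻ r c∈)))
    (trans (total-const (𝟙 (not (containsStop r))) (children r))
        (trans (cong (_* 𝟙 (not (containsStop r))) (length-children r)) (lem r)))
    where
    lem : ∀ r → siblings (blocks r) * 𝟙 (not (containsStop r)) ≡ live siblings r
    lem r with containsStop r
    ... | true  = *-zeroʳ (siblings (blocks r))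
    ... | false = *-identityʳ _

-- The insertion tree of permutations and the pattern 213

-- The letters 1 and 3 of an occurrence of 213 whose 2 is an `x` standing in front of the list.
data Peak (x : ℕ) : List ℕ → Set where
  here  : ∀ {y l} → y < x → Any (x <_) l → Peak x (y ∷ l)
  there : ∀ {y l} → Peak x l → Peak x (y ∷ l)

data Has213 : List ℕ → Set where
  here  : ∀ {x l} → Peak x l → Has213 (x ∷ l)
  there : ∀ {x l} → Has213 l → Has213 (x ∷ l)

T-any-upTo⁻ : ∀ p n → T (any p (upTo n)) → ∃[ i ] i < n × T (p i)
T-any-upTo⁻ p n t with find (Anyₚ.any⁻ p (upTo n) t)
... | i , i∈ , q = i , ∈-upTo⁻ i∈ , q

T-any-upTo⁺ : ∀ p {n i} → i < n → T (p i) → T (any p (upTo n))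
T-any-upTo⁺ p i<n q = Anyₚ.any⁺ p (lose (∈-upTo⁺ i<n) q)

at⇒Any : ∀ {P : ℕ → Set} l i → i < length l → P (at l i) → Any P l
at⇒Any (x ∷ l) zero    lt p = here p
at⇒Any (x ∷ l) (suc i) lt p = there (at⇒Any l i (s≤s⁻¹ lt) p)

Any⇒at : ∀ {P : ℕ → Set} l → Any P l → ∃[ i ] i < length l × P (at l i)
Any⇒at (x ∷ l) (here p)  = 0 , z<s , p
Any⇒at (x ∷ l) (there a) with Any⇒at l a
... | i , lt , p = suc i , s<s lt , p

at⇒Peak : ∀ {x} l j k → j < k → k < length l → at l j < x → x < at l k → Peak x l
at⇒Peak (y ∷ l) zero    (suc k) _   k< p q = here p (at⇒Any l k (s≤s⁻¹ k<) q)
at⇒Peak (y ∷ l) (suc j) (suc k) j<k k< p q = there (at⇒Peak l j k (s≤s⁻¹ j<k) (s≤s⁻¹ k<) p q)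

Peak⇒at : ∀ {x} l → Peak x l → ∃[ j ] ∃[ k ] j < k × k < length l × at l j < x × x < at l k
Peak⇒at (y ∷ l) (here p a) with Any⇒at l a
... | k , k< , q = 0 , suc k , z<s , s<s k< , p , q
Peak⇒at (y ∷ l) (there p) with Peak⇒at l p
... | j , k , j<k , k< , q = suc j , suc k , s<s j<k , s<s k< , q

at⇒Has213 : ∀ s i j k → i < j → j < k → k < length s → at s j < at s i → at s i < at s k → Has213 s
at⇒Has213 (x ∷ s) zero (suc j) (suc k) _ j<k k< p q = here (at⇒Peak s j k (s≤s⁻¹ j<k) (s≤s⁻¹ k<) p q)
at⇒Has213 (x ∷ s) (suc i) (suc j) (suc k) i<j j<k k< p q = there (at⇒Has213 s i j k (s≤s⁻¹ i<j) (s≤s⁻¹ j<k) (s≤s⁻¹ k<) p q)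

Has213⇒at : ∀ s → Has213 s → ∃[ i ] ∃[ j ] ∃[ k ] i < j × j < k × k < length s × at s j < at s i × at s i < at s k
Has213⇒at (x ∷ s) (here p) with Peak⇒at s p
... | j , k , j<k , k< , q = 0 , suc j , suc k , z<s , s<s j<k , s<s k< , q
Has213⇒at (x ∷ s) (there h) with Has213⇒at s h
... | i , j , k , i<j , j<k , k< , q = suc i , suc j , suc k , s<s i<j , s<s j<k , s<s k< , q

contains⇒Has213 : ∀ s → contains213 s ≡ true → Has213 s
contains⇒Has213 s e with T-any-upTo⁻ _ (length s) (≡true⇒T e)
... | k , k< , t with T-any-upTo⁻ _ k t
... | j , j<k , t′ with T-any-upTo⁻ _ j t′
... | i , i<j , t″ with Equivalence.to (T-∧ {at s j <ᵇ at s i}) t″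
... | p , q = at⇒Has213 s i j k i<j j<k k< (<ᵇ⇒< _ _ p) (<ᵇ⇒< _ _ q)

Has213⇒contains : ∀ {s} → Has213 s → contains213 s ≡ true
Has213⇒contains {s} h with Has213⇒at s h
... | i , j , k , i<j , j<k , k< , p , q = T⇒≡true (T-any-upTo⁺ _ k< (T-any-upTo⁺ _ j<k (T-any-upTo⁺ _ i<j
  (Equivalence.from (T-∧ {at s j <ᵇ at s i}) (<⇒<ᵇ p , <⇒<ᵇ q)))))

¬Has213⇒avoids : ∀ {s} → ¬ Has213 s → contains213 s ≡ false
¬Has213⇒avoids {s} nh with contains213 s in eq
... | true  = ⊥-elim (nh (contains⇒Has213 s eq))
... | false = refl

avoids⇒¬Has213 : ∀ {s} → contains213 s ≡ false → ¬ Has213 s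
avoids⇒¬Has213 e h with trans (sym e) (Has213⇒contains h)
... | ()

-- Permutations generated by inserting the maximum

data Insertion (n : ℕ) : List ℕ → List ℕ → Set where
  here  : ∀ {l} → Insertion n l (n ∷ l)
  there : ∀ {x l τ} → Insertion n l τ → Insertion n (x ∷ l) (x ∷ τ)

insertions : ℕ → List ℕ → List (List ℕ)
insertions n []      = (n ∷ []) ∷ []
insertions n (x ∷ l) = (n ∷ x ∷ l) ∷ map (x ∷_) (insertions n l)

∈-insertions⁻ : ∀ n l {τ} → τ ∈ insertions n l → Insertion n l τ
∈-insertions⁻ n []      (here refl) = here
∈-insertions⁻ n (x ∷ l) (here refl) = here
∈-insertions⁻ n (x ∷ l) (there p) with ∈-map⁻ (x ∷_) p
... | τ , τ∈ , refl = there (∈-insertions⁻ n l τ∈)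

∈-insertions⁺ : ∀ {n l τ} → Insertion n l τ → τ ∈ insertions n l
∈-insertions⁺ {l = []}    here      = here refl
∈-insertions⁺ {l = _ ∷ _} here      = here refl
∈-insertions⁺             (there i) = there (∈-map⁺ (_ ∷_) (∈-insertions⁺ i))

Insertion-max : ∀ {n l τ} → Insertion n l τ → n ∈ τ
Insertion-max here      = here refl
Insertion-max (there i) = there (Insertion-max i)

Insertion-⊆ : ∀ {n l τ v} → Insertion n l τ → v ∈ τ → v ≡ n ⊎ v ∈ l
Insertion-⊆ here      (here e)  = inj₁ e
Insertion-⊆ here      (there p) = inj₂ p
Insertion-⊆ (there i) (here e)  = inj₂ (here e)
Insertion-⊆ (there i) (there p) with Insertion-⊆ i p
... | inj₁ e = inj₁ e
... | inj₂ q = inj₂ (there q)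

Insertion-Any : ∀ {P : ℕ → Set} {n l τ} → Insertion n l τ → Any P l → Any P τ
Insertion-Any here      a         = there a
Insertion-Any (there i) (here p)  = here p
Insertion-Any (there i) (there a) = there (Insertion-Any i a)

Insertion-Peak : ∀ {x n l τ} → Insertion n l τ → Peak x l → Peak x τ
Insertion-Peak here      p          = there p
Insertion-Peak (there i) (here p a) = here p (Insertion-Any i a)
Insertion-Peak (there i) (there p)  = there (Insertion-Peak i p)

Insertion-Has213 : ∀ {n l τ} → Insertion n l τ → Has213 l → Has213 τ
Insertion-Has213 here      h         = there h
Insertion-Has213 (there i) (here p)  = here (Insertion-Peak i p)
Insertion-Has213 (there i) (there h) = there (Insertion-Has213 i h)

Below : ℕ → List ℕ → Set
Below n l = ∀ {v} → v ∈ l → v < n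

deleteMax-insertion : ∀ {n l τ} → Below n l → Insertion n l τ → deleteMax (suc n) τ ≡ l
deleteMax-insertion {n} {l} b here rewrite T⇒≡true (≡⇒≡ᵇ n n refl) = keep l b
  where
  keep : ∀ l → Below n l → deleteMax (suc n) l ≡ l
  keep []      b = refl
  keep (x ∷ l) b with x ≡ᵇ n in e
  ... | true  = ⊥-elim (<⇒≢ (b (here refl)) (≡ᵇ⇒≡ x n (≡true⇒T e)))
  ... | false = cong (x ∷_) (keep l (b ∘ there))
deleteMax-insertion {n} b (there {x} i) with x ≡ᵇ n in e
... | true  = ⊥-elim (<⇒≢ (b (here refl)) (≡ᵇ⇒≡ x n (≡true⇒T e)))
... | false = cong (x ∷_) (deleteMax-insertion (b ∘ there) i)

insertions-unique : ∀ {n} l → Below n l → Unique (insertions n l)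
insertions-unique []      b = [] ∷ []
insertions-unique (x ∷ l) b = All.tabulate (λ p e → neq p e) ∷ Uniq.map⁺ (proj₂ ∘ ∷-injective)
    (insertions-unique l (b ∘ there))
  where
  neq : ∀ {τ} → τ ∈ map (x ∷_) (insertions _ l) → _ ∷ x ∷ l ≢ τ
  neq p e with ∈-map⁻ (x ∷_) p
  ... | _ , _ , refl = <⇒≢ (b (here refl)) (sym (proj₁ (∷-injective e)))

permTree : ℕ → List (List ℕ)
permTree zero    = [] ∷ []
permTree (suc n) = concatMap (insertions n) (permTree n)

IsPerm : ℕ → List ℕ → Set
IsPerm n σ = length σ ≡ n × Below n σ × Unique σ

T-not⁻ : ∀ {b} → T (not b) → ¬ T b
T-not⁻ {false} _ ()

T-not⁺ : ∀ {b} → ¬ T b → T (not b)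
T-not⁺ {false} _ = _
T-not⁺ {true}  f = ⊥-elim (f _)

distinct⇒Unique : ∀ l → T (distinct l) → Unique l
distinct⇒Unique []      _ = []
distinct⇒Unique (x ∷ l) t with Equivalence.to (T-∧ {not (any (λ y → x ≡ᵇ y) l)}) t
... | p , q = All.tabulate (λ {y} y∈ e → T-not⁻ p (Anyₚ.any⁺ _ (lose y∈ (≡⇒≡ᵇ x y e)))) ∷ distinct⇒Unique l q

Unique⇒distinct : ∀ {l} → Unique l → T (distinct l)
Unique⇒distinct []      = _
Unique⇒distinct {x ∷ l} (x∉ ∷ u) = Equivalence.from (T-∧ {not (any (λ y → x ≡ᵇ y) l)}) (T-not⁺ no-eq , Unique⇒distinct u)
  where
  no-eq : ¬ T (any (λ y → x ≡ᵇ y) l)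
  no-eq t with find (Anyₚ.any⁻ _ l t)
  ... | y , y∈ , e = All.lookup x∉ y∈ (≡ᵇ⇒≡ x y e)

∈-perms⁻ : ∀ {n σ} → σ ∈ perms n → IsPerm n σ
∈-perms⁻ {n} {σ} p with ∈-filterᵇ⁻ distinct {xs = lists n n} p
... | q , d with ∈-lists⁻ n n q
... | len , bd = len , All.lookup bd , distinct⇒Unique σ d

∈-perms⁺ : ∀ {n σ} → IsPerm n σ → σ ∈ perms n
∈-perms⁺ {σ = σ} (refl , b , u) = ∈-filterᵇ⁺ distinct (∈-lists⁺ σ (All.tabulate b)) (Unique⇒distinct u)

Insertion-length : ∀ {n l τ} → Insertion n l τ → length τ ≡ suc (length l)
Insertion-length here      = refl
Insertion-length (there i) = cong suc (Insertion-length i)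

Insertion-Unique : ∀ {n l τ} → Below n l → Unique l → Insertion n l τ → Unique τ
Insertion-Unique b u here = All.tabulate (λ v∈ e → <⇒≢ (b v∈) (sym e)) ∷ u
Insertion-Unique b (x∉ ∷ u) (there {x} i) = All.tabulate neq ∷ Insertion-Unique (b ∘ there) u i
  where
  neq : ∀ {v} → v ∈ _ → x ≢ v
  neq v∈ e with Insertion-⊆ i v∈
  ... | inj₁ refl = <⇒≢ (b (here refl)) e
  ... | inj₂ v∈l  = All.lookup x∉ v∈l e

∈-permTree⁻ : ∀ n {σ} → σ ∈ permTree n → IsPerm n σ
∈-permTree⁻ zero    (here refl) = refl , (λ ()) , []
∈-permTree⁻ (suc n) p with ∈-concatMap⁻¹ (insertions n) (permTree n) p
... | σ , σ∈ , q with ∈-permTree⁻ n σ∈ | ∈-insertions⁻ n σ q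
... | len , b , u | i = trans (Insertion-length i) (cong suc len)
  , (λ v∈ → [ (λ { refl → n<1+n n }) , (λ v∈σ → m<n⇒m<1+n (b v∈σ)) ]′ (Insertion-⊆ i v∈))
  , Insertion-Unique b u i

max-∈ : ∀ {n τ} → IsPerm (suc n) τ → n ∈ τ
max-∈ {n} {τ} (len , b , u) with Any.any? (n ≟_) τ
... | yes p = p
... | no ¬p = ⊥-elim (<⇒≱ (n<1+n n) (subst₂ _≤_ len (length-upTo n) (unique-⊆-length u sub)))
  where
  sub : ∀ {v} → v ∈ τ → v ∈ upTo n
  sub v∈ = ∈-upTo⁺ (≤∧≢⇒< (s≤s⁻¹ (b v∈)) (λ { refl → ¬p v∈ }))

remove-Insertion : ∀ {n τ} → Unique τ → n ∈ τ → ∃[ σ ] Insertion n σ τ × Unique σ × (∀ {v} → v ∈ σ → v ≢ n × v ∈ τ)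
remove-Insertion {τ = x ∷ τ} (x∉ ∷ u) (here refl) = τ , here , u , λ v∈ → (λ e → All.lookup x∉ v∈ (sym e)) , there v∈
remove-Insertion {τ = x ∷ τ} (x∉ ∷ u) (there p) with remove-Insertion u p
... | σ , i , u′ , f = x ∷ σ , there i , All.tabulate (λ v∈ → All.lookup x∉ (proj₂ (f v∈))) ∷ u′
  , λ { (here refl) → (λ { refl → All.lookup x∉ p refl }) , here refl ; (there v∈) → proj₁ (f v∈) , there (proj₂ (f v∈)) }

∈-permTree⁺ : ∀ n {σ} → IsPerm n σ → σ ∈ permTree n
∈-permTree⁺ zero    {[]} _ = here refl
∈-permTree⁺ (suc n) {τ} (len , b , u) with remove-Insertion u (max-∈ (len , b , u))
... | σ , i , u′ , f = ∈-concatMap (insertions n) (∈-permTree⁺ n (suc-injective (trans (sym (Insertion-length i)) len)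
  , (λ v∈ → ≤∧≢⇒< (s≤s⁻¹ (b (proj₂ (f v∈)))) (proj₁ (f v∈))) , u′)) (∈-insertions⁺ i)

permTree-unique : ∀ n → Unique (permTree n)
permTree-unique zero    = [] ∷ []
permTree-unique (suc n) = concatMap-unique (insertions n) (deleteMax (suc n)) (permTree-unique n)
  (λ {σ} σ∈ → insertions-unique σ (proj₁ (proj₂ (∈-permTree⁻ n σ∈))))
  (λ {σ} σ∈ τ∈ → deleteMax-insertion (proj₁ (proj₂ (∈-permTree⁻ n σ∈))) (∈-insertions⁻ n σ τ∈))

perms↭permTree : ∀ n → perms n ↭ permTree n
perms↭permTree n = enumerations-↭ (Uniq.filter⁺ _ (lists-unique n n)) (permTree-unique n)
  (∈-permTree⁺ n ∘ ∈-perms⁻) (∈-perms⁺ ∘ ∈-permTree⁻ n)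

-- Initial run, descents, and the insertions that keep avoiding 213

desFrom ascFrom runFrom : ℕ → List ℕ → ℕ
desFrom p []      = 0
desFrom p (y ∷ l) = 𝟙 (y <ᵇ p) + desFrom y l
ascFrom p []      = 0
ascFrom p (y ∷ l) = 𝟙 (not (y <ᵇ p)) + ascFrom y l
runFrom p []      = 0
runFrom p (y ∷ l) = if y <ᵇ p then 0 else suc (runFrom y l)

des nondes run : List ℕ → ℕ
des []         = 0
des (x ∷ l)    = desFrom x l
nondes []      = 0
nondes (x ∷ l) = suc (ascFrom x l)
run []         = 0
run (x ∷ l)    = suc (runFrom x l)

descents≡des : ∀ s → descents s ≡ des s
descents≡des []      = refl
descents≡des (x ∷ l) = trans (count-total _ (upTo (length l))) (trans (sum-upTo _ (length l)) (go x l))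
  where
  go : ∀ x l → ∑ (length l) (λ i → 𝟙 (at (x ∷ l) (suc i) <ᵇ at (x ∷ l) i)) ≡ desFrom x l
  go x []      = refl
  go x (y ∷ l) = trans (∑-suc (length l) _) (cong (𝟙 (y <ᵇ x) +_) (go y l))

-- An arbitrary function of run, descents and non-descents. The induction in `total-insertions`
-- changes it, absorbing each entry passed over in the initial run.
Stat : Set
Stat = ℕ → ℕ → ℕ → ℕ

stat : Stat → List ℕ → ℕ
stat G τ = G (run τ) (des τ) (nondes τ)

surviving : Stat → List ℕ → ℕ
surviving G τ = if contains213 τ then 0 else stat G τ

surviving-dead : ∀ G {τ} → Has213 τ → surviving G τ ≡ 0
surviving-dead G h rewrite Has213⇒contains h = refl

surviving-avoids : ∀ G {τ} → ¬ Has213 τ → surviving G τ ≡ stat G τ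
surviving-avoids G nh rewrite ¬Has213⇒avoids nh = refl

surviving-cong : ∀ G {τ τ′} → (Has213 τ → Has213 τ′) → (Has213 τ′ → Has213 τ) → ∀ H → stat G τ ≡ stat H τ′ → surviving G τ
    ≡ surviving H τ′
surviving-cong G {τ} {τ′} f g H e with contains213 τ in eq
... | true  = sym (surviving-dead H (f (contains⇒Has213 τ eq)))
... | false = trans e (sym (surviving-avoids H (avoids⇒¬Has213 {τ} eq ∘ g)))

below-no-Peak : ∀ {n l} → Below n l → ¬ Peak n l
below-no-Peak b (here _ a) with find a
... | v , v∈ , n<v = <-asym n<v (b (there v∈))
below-no-Peak b (there p) = below-no-Peak (b ∘ there) p

-- For x ≤ y, an occurrence 2-1-3 created by n with x as its 2 is matched by one with y as its 2.
Insertion-Peak⁻ : ∀ {n l τ x y} → x ≤ y → y < n → Insertion n l τ → Peak x τ → Peak x l ⊎ Peak y τ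
Insertion-Peak⁻ x≤y y<n here (here n<x _) = ⊥-elim (<-asym (≤-trans n<x x≤y) y<n)
Insertion-Peak⁻ x≤y y<n here (there p)    = inj₁ p
Insertion-Peak⁻ x≤y y<n (there i) (here z<x _) = inj₂ (here (≤-trans z<x x≤y) (lose (Insertion-max i) y<n))
Insertion-Peak⁻ x≤y y<n (there i) (there p) with Insertion-Peak⁻ x≤y y<n i p
... | inj₁ q = inj₁ (there q)
... | inj₂ q = inj₂ (there q)

InsertionSum : ℕ → List ℕ → Set
InsertionSum n σ = Below n σ → ¬ Has213 σ → ∀ G → total (surviving G) (insertions n σ) ≡
  G (suc (run σ)) (des σ) (suc (nondes σ)) + ∑ (run σ) (λ s → G (suc s) (suc (des σ)) (nondes σ))

-- Behind the descent that ends the initial run, the maximum is the 3 over that descent. At the end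
-- of the run it adds a non-descent; at any earlier place it cuts the run and adds a descent.
total-insertions : ∀ {n} σ → InsertionSum n σ
total-insertions {n} []      b nh G = cong (_+ 0) (surviving-avoids G {n ∷ []} λ { (here ()) ; (there ()) })
total-insertions {n} (x ∷ l) b nh G = trans (cong₂ _+_ first (rest l (total-insertions l) b nh))
    (trans (+-comm (G 1 (suc (des (x ∷ l))) (nondes (x ∷ l))) _)
  (trans (+-assoc (G (suc (run (x ∷ l))) (des (x ∷ l)) (suc (nondes (x ∷ l)))) _ _)
   (cong (G (suc (run (x ∷ l))) (des (x ∷ l)) (suc (nondes (x ∷ l))) +_)
       (trans (+-comm _ (G 1 (suc (des (x ∷ l))) (nondes (x ∷ l)))) (sym (∑-suc (runFrom x l) _))))))
  where
  x<n : x < n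
  x<n = b (here refl)
  first : surviving G (n ∷ x ∷ l) ≡ G 1 (suc (desFrom x l)) (suc (ascFrom x l))
  first = trans (surviving-avoids G λ { (here p) → below-no-Peak b p ; (there h) → nh h }) eq
    where
    eq : stat G (n ∷ x ∷ l) ≡ G 1 (suc (desFrom x l)) (suc (ascFrom x l))
    eq rewrite <ᵇ-true x<n = refl
  rest : ∀ l → InsertionSum n l → Below n (x ∷ l) → ¬ Has213 (x ∷ l) → total (surviving G) (map (x ∷_) (insertions n l)) ≡
    G (suc (run (x ∷ l))) (des (x ∷ l)) (suc (nondes (x ∷ l))) + ∑ (runFrom x l)
        (λ s → G (suc (suc s)) (suc (des (x ∷ l))) (nondes (x ∷ l)))
  rest [] _ b nh = cong (_+ 0) (trans (surviving-avoids G {x ∷ n ∷ []} λ { (here (there ())) ; (here (here _ ())) ;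
      (there (here ())) ; (there (there ())) }) eq)
    where
    eq : stat G (x ∷ n ∷ []) ≡ G 2 0 2
    eq rewrite <ᵇ-false (<⇒≤ x<n) = refl
  rest (y ∷ l) ih b nh with <-≤-connex y x
  -- The run ends at `x`. Only the place between `x` and `y` survives: anywhere behind `y` the
  -- entries `x`, `y`, `n` form 213.
  ... | inj₁ y<x rewrite <ᵇ-true y<x = cong₂ _+_
    (trans (surviving-avoids G avoid) eq)
    (trans (total-map (surviving G) (x ∷_) (map (y ∷_) (insertions n l)))
        (trans (total-map (surviving G ∘ (x ∷_)) (y ∷_) (insertions n l))
      (total-zero (insertions n l) (λ τ∈ → surviving-dead G (here
          (here y<x (lose (Insertion-max (∈-insertions⁻ n l τ∈)) x<n)))))))
    where
    avoid : ¬ Has213 (x ∷ n ∷ y ∷ l)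
    avoid (here (here n<x _))  = <-asym n<x x<n
    avoid (here (there p))     = nh (here p)
    avoid (there (here p))     = below-no-Peak (b ∘ there) p
    avoid (there (there h))    = nh (there h)
    eq : stat G (x ∷ n ∷ y ∷ l) ≡ G 2 (suc (desFrom y l)) (suc (suc (ascFrom y l)))
    eq rewrite <ᵇ-false (<⇒≤ x<n) | <ᵇ-true (b (there (here refl))) = refl
  ... | inj₂ x≤y rewrite <ᵇ-false x≤y = trans (total-map (surviving G) (x ∷_) (insertions n (y ∷ l)))
    (trans (total-cong (insertions n (y ∷ l)) (λ τ∈ → step (∈-insertions⁻ n (y ∷ l) τ∈)))
      (ih (b ∘ there) (nh ∘ there) G′))
    where
    -- A leading `x ≤ y` lengthens the run by one and adds one non-descent, whichever place the
    -- maximum takes behind it.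
    G′ : Stat
    G′ i d u = G (suc i) d (suc u)
    y<n : y < n
    y<n = b (there (here refl))
    stat-step : ∀ {τ} → Insertion n (y ∷ l) τ → stat G (x ∷ τ) ≡ stat G′ τ
    stat-step here rewrite <ᵇ-false (<⇒≤ x<n) = refl
    stat-step (there i) rewrite <ᵇ-false x≤y = refl
    drop : ∀ {τ} → Insertion n (y ∷ l) τ → Has213 (x ∷ τ) → Has213 τ
    drop i         (there h)             = h
    drop here      (here (here n<x _))   = ⊥-elim (<-asym n<x x<n)
    drop here      (here (there p))      = ⊥-elim (nh (here p))
    drop (there i) (here (here y<x _))   = ⊥-elim (<⇒≱ y<x x≤y)
    drop (there i) (here (there p)) with Insertion-Peak⁻ x≤y y<n i p
    ... | inj₁ q = ⊥-elim (nh (here (there q)))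
    ... | inj₂ q = here q
    step : ∀ {τ} → Insertion n (y ∷ l) τ → surviving G (x ∷ τ) ≡ surviving G′ τ
    step i = surviving-cong G (drop i) there G′ (stat-step i)

-- Sum of φ over the numbers of blocks of the 2 ^ d chains obtained from a permutation with d descents and
-- u non-descents (counting its first entry) by merging blocks across a subset of its descents.
merged : ℕ → ℕ → (ℕ → ℕ) → ℕ
merged zero    u φ = φ u
merged (suc d) u φ = merged d u φ + merged d (suc u) φ

mergedStat : (ℕ → ℕ) → Stat
mergedStat φ _ d u = merged d u φ

descendP : ℕ → ℕ → (ℕ → ℕ) → List ℕ → ℕ
descendP zero    n φ σ = surviving (mergedStat φ) σ
descendP (suc m) n φ σ = total (descendP m (suc n) φ) (insertions n σ)

total-permTree : ∀ m n φ → total (descendP m n φ) (permTree n) ≡ total (surviving (mergedStat φ)) (permTree (m + n))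
total-permTree zero    n φ = refl
total-permTree (suc m) n φ = trans (sym (total-concatMap (descendP m (suc n) φ) (insertions n) (permTree n)))
  (trans (total-permTree m (suc n) φ) (cong (λ j → total (surviving (mergedStat φ)) (permTree j)) (+-suc m n)))

descendP-dead : ∀ m n φ {σ} → Has213 σ → descendP m n φ σ ≡ 0
descendP-dead zero    n φ h = surviving-dead (mergedStat φ) h
descendP-dead (suc m) n φ {σ} h = total-zero (insertions n σ)
  (λ τ∈ → descendP-dead m (suc n) φ (Insertion-Has213 (∈-insertions⁻ n σ τ∈) h))

Insertion-Below : ∀ {n l τ} → Below n l → Insertion n l τ → Below (suc n) τ
Insertion-Below b i v∈ with Insertion-⊆ i v∈
... | inj₁ refl = n<1+n _
... | inj₂ v∈l  = m<n⇒m<1+n (b v∈l)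

F-stat : ℕ → (ℕ → ℕ) → Stat
F-stat m φ i d u = F m i (λ j → merged d (j + u) φ)

descendP-F : ∀ m n φ {σ} → Below n σ → descendP m n φ σ ≡ surviving (F-stat m φ) σ
descendP-F zero    n φ {σ} b = refl
descendP-F (suc m) n φ {σ} b with contains213 σ in eq
... | true  = descendP-dead (suc m) n φ (contains⇒Has213 σ eq)
... | false = trans
  (total-cong (insertions n σ) (λ τ∈ → descendP-F m (suc n) φ (Insertion-Below b (∈-insertions⁻ n σ τ∈))))
  (trans (total-insertions σ b (avoids⇒¬Has213 {σ} eq) (F-stat m φ))
  (trans (cong (_+ ∑ (run σ) (λ s → F-stat m φ (suc s) (suc (des σ)) (nondes σ)))
    (F-cong m (suc (run σ)) (λ j → cong (λ t → merged (des σ) t φ) (+-suc j (nondes σ)))))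
  -- A child with one more descent carries `merged (suc d)`, which unfolds to the weight
  -- `φ k + φ (suc k)` of `F-run-step`.
  (sym (F-run-step m (run σ) (λ j → merged (des σ) (j + nondes σ) φ)))))

surviving-permTree : ∀ n φ → total (surviving (mergedStat φ)) (permTree n) ≡ F n 0 φ
surviving-permTree n φ = trans (cong (total (surviving (mergedStat φ)) ∘ permTree) (sym (+-identityʳ n)))
  (trans (sym (total-permTree n 0 φ)) (trans (+-identityʳ _) (trans (descendP-F n 0 φ {[]} (λ ()))
    (F-cong n 0 (λ j → cong φ (+-identityʳ j))))))

-- Permutations in which the maximum creates the pattern 213

merged-one : ∀ d u → merged d u one ≡ 2 ^ d
merged-one zero    u = refl
merged-one (suc d) u = cong₂ _+_ (merged-one d u) (trans (merged-one d (suc u)) (sym (+-identityʳ (2 ^ d))))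

-- Over the 2^d subsets of descents the number of unmerged ones averages d/2, so the number of
-- children averages 2u + d + 1.
merged-siblings : ∀ d u → merged d u siblings ≡ suc d * 2 ^ d + u * 2 ^ suc d
merged-siblings zero    u = lem u
  where
  lem : ∀ u → suc u + u ≡ 1 * 1 + u * 2
  lem = ℕ-Solver.solve-∀
merged-siblings (suc d) u = trans (cong₂ _+_ (merged-siblings d u) (merged-siblings d (suc u))) (lem d u (2 ^ d))
  where
  lem : ∀ d u p → (suc d * p + u * (2 * p)) + (suc d * p + suc u * (2 * p)) ≡ suc (suc d) * (2 * p) + u * (2 * (2 * p))
  lem = ℕ-Solver.solve-∀

-- The maximum placed inside a descent or at the end leaves the number of descents unchanged; placed
-- inside a non-descent it adds one.
total-desFrom : ∀ {n} p l → p < n → Below n l → ∀ f →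
  total (f ∘ desFrom p) (insertions n l) ≡ suc (desFrom p l) * f (desFrom p l) + ascFrom p l * f (suc (desFrom p l))
total-desFrom p [] p<n b f rewrite <ᵇ-false (<⇒≤ p<n) = sym (+-identityʳ (f 0 + 0))
total-desFrom {n} p (y ∷ l) p<n b f rewrite <ᵇ-false (<⇒≤ p<n) | <ᵇ-true (b (here refl)) = trans
  (cong (f (suc (desFrom y l)) +_) (trans (total-map (f ∘ desFrom p) (y ∷_) (insertions n l))
    (total-desFrom y l (b (here refl)) (b ∘ there) (λ e → f (𝟙 (y <ᵇ p) + e)))))
  (lem (y <ᵇ p))
  where
  D A : ℕ
  D = desFrom y l
  A = ascFrom y l
  lem : ∀ c → f (suc D) + (suc D * f (𝟙 c + D) + A * f (𝟙 c + suc D)) ≡ suc (𝟙 c + D) * f (𝟙 c + D) + (𝟙 (not c) + A) * f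
      (suc (𝟙 c + D))
  lem true  = sym (+-assoc (f (suc D)) (suc D * f (suc D)) _)
  lem false = swap (f (suc D)) (suc D * f D) _
    where
    swap : ∀ a b c → a + (b + c) ≡ b + (a + c)
    swap = ℕ-Solver.solve-∀

-- The front place adds a descent too, which makes `nondes σ` places of weight 2^(d+1) beside the d
-- + 1 places of weight 2^d when σ is nonempty. This is exactly `merged-siblings`: all insertions
-- into σ weigh as much as all children of the chains that σ stands for.
total-des : ∀ {n} σ → Below n σ → total (λ τ → 2 ^ des τ) (insertions n σ) ≡ merged (des σ) (nondes σ) siblings
total-des []      b = refl
total-des {n} (x ∷ l) b rewrite <ᵇ-true (b (here refl)) = trans
  (cong (2 ^ suc (desFrom x l) +_) (trans (total-map (λ τ → 2 ^ des τ) (x ∷_) (insertions n l))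
      (total-desFrom x l (b (here refl)) (b ∘ there) (2 ^_))))
  (trans (lem (2 ^ suc (desFrom x l)) (suc (desFrom x l) * 2 ^ desFrom x l) (ascFrom x l))
    (sym (merged-siblings (desFrom x l) (suc (ascFrom x l)))))
  where
  lem : ∀ q s a → q + (s + a * q) ≡ s + suc a * q
  lem = ℕ-Solver.solve-∀

first213 : ℕ → List ℕ → Bool
first213 j s = contains213 s ∧ not (contains213 (deleteMax j s))

-- The counterpart of `stopping-leaves` with the same right-hand side and the same added term, so
-- the two kinds of leaves can be compared by cancellation.
first213-total : ∀ n → total (λ s → 𝟙 (first213 (suc n) s) * 2 ^ des s) (perms (suc n)) + F (suc n) 0 one ≡ F n 0 siblings
first213-total n = begin
  total p (perms (suc n)) + F (suc n) 0 one
    ≡⟨ cong₂ _+_ (total-↭ p (perms↭permTree (suc n))) (sym (surviving-permTree (suc n) one)) ⟩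
  total p (permTree (suc n)) + total (surviving (mergedStat one)) (permTree (suc n))
    ≡⟨ total-+ p (surviving (mergedStat one)) (permTree (suc n)) ⟨
  total q (permTree (suc n))
    ≡⟨ total-concatMap q (insertions n) (permTree n) ⟩
  total (λ σ → total q (insertions n σ)) (permTree n)
    ≡⟨ total-cong (permTree n) (λ {σ} σ∈ → family σ (proj₁ (proj₂ (∈-permTree⁻ n σ∈)))) ⟩
  total (surviving (mergedStat siblings)) (permTree n)
    ≡⟨ surviving-permTree n siblings ⟩
  F n 0 siblings ∎
  where
  open ≡-Reasoning
  p q : List ℕ → ℕ
  p s = 𝟙 (first213 (suc n) s) * 2 ^ des s
  q s = p s + surviving (mergedStat one) s
  q-dead : ∀ {σ τ} → Below n σ → Insertion n σ τ → Has213 σ → q τ ≡ 0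
  q-dead b i h rewrite deleteMax-insertion b i | Has213⇒contains h | Has213⇒contains (Insertion-Has213 i h) = refl
  q-surviving : ∀ {σ τ} → Below n σ → Insertion n σ τ → contains213 σ ≡ false → q τ ≡ 2 ^ des τ
  q-surviving {σ} {τ} b i e rewrite deleteMax-insertion b i | e with contains213 τ
  ... | true  = trans (+-identityʳ _) (+-identityʳ _)
  ... | false = merged-one (des τ) (nondes τ)
  family : ∀ σ → Below n σ → total q (insertions n σ) ≡ surviving (mergedStat siblings) σ
  family σ b with contains213 σ in eq
  ... | true  = total-zero (insertions n σ) (λ τ∈ → q-dead b (∈-insertions⁻ n σ τ∈) (contains⇒Has213 σ eq))
  ... | false = trans (total-cong (insertions n σ) (λ τ∈ → q-surviving b (∈-insertions⁻ n σ τ∈) eq)) (total-des σ b)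

-- The range of the descent number, and the sum over `ell`

desFrom-zero : ∀ p l → desFrom p l ≡ 0 → ∀ {v} → v ∈ l → p ≤ v
desFrom-zero p (y ∷ l) e v∈ with <-≤-connex y p
... | inj₁ y<p rewrite <ᵇ-true y<p = ⊥-elim (1+n≢0 e)
desFrom-zero p (y ∷ l) e (here refl) | inj₂ p≤y = p≤y
desFrom-zero p (y ∷ l) e (there v∈)  | inj₂ p≤y rewrite <ᵇ-false p≤y = ≤-trans p≤y (desFrom-zero y l e v∈)

ascFrom-zero : ∀ p l → ascFrom p l ≡ 0 → ∀ {v} → v ∈ l → v < p
ascFrom-zero p (y ∷ l) e v∈ with <-≤-connex y p
... | inj₂ p≤y rewrite <ᵇ-false p≤y = ⊥-elim (1+n≢0 e)
ascFrom-zero p (y ∷ l) e (here refl) | inj₁ y<p = y<p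
ascFrom-zero p (y ∷ l) e (there v∈)  | inj₁ y<p rewrite <ᵇ-true y<p = <-trans (ascFrom-zero y l e v∈) y<p

Peak-∃< : ∀ {x l} → Peak x l → ∃[ v ] v ∈ l × v < x
Peak-∃< (here p _) = _ , here refl , p
Peak-∃< (there p) with Peak-∃< p
... | v , v∈ , lt = v , there v∈ , lt

Peak-∃> : ∀ {x l} → Peak x l → ∃[ v ] v ∈ l × x < v
Peak-∃> (here _ a) with find a
... | v , v∈ , lt = v , there v∈ , lt
Peak-∃> (there p) with Peak-∃> p
... | v , v∈ , lt = v , there v∈ , lt

-- Without a descent nothing later is smaller than the 2; without an ascent nothing later is larger.
Has213-des : ∀ {x l} → Has213 (x ∷ l) → 0 < desFrom x l × 0 < ascFrom x l
Has213-des {x} {l} (here p) =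
    n≢0⇒n>0 (λ e → let v , v∈ , lt = Peak-∃< p in <⇒≱ lt (desFrom-zero x l e v∈))
  , n≢0⇒n>0 (λ e → let v , v∈ , lt = Peak-∃> p in <-asym lt (ascFrom-zero x l e v∈))
Has213-des {x} {y ∷ l} (there h) = let d , a = Has213-des h in
  ≤-trans d (m≤n+m _ (𝟙 (y <ᵇ x))) , ≤-trans a (m≤n+m _ (𝟙 (not (y <ᵇ x))))

desFrom+ascFrom : ∀ p l → desFrom p l + ascFrom p l ≡ length l
desFrom+ascFrom p []      = refl
desFrom+ascFrom p (y ∷ l) = trans (lem (y <ᵇ p) (desFrom y l) (ascFrom y l)) (cong suc (desFrom+ascFrom y l))
  where
  lem : ∀ c d a → (𝟙 c + d) + (𝟙 (not c) + a) ≡ suc (d + a)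
  lem true  d a = refl
  lem false d a = +-suc d a

-- Descents and ascents add up to one less than the length and both occur, which gives the range
-- from 1 to j - 2; the witness `d` is shifted down by one.
Has213-des-range : ∀ s → Has213 s → ∃[ d ] des s ≡ suc d × d < length s ∸ 2
Has213-des-range (x ∷ l) h with Has213-des h | desFrom+ascFrom x l
... | d>0 , a>0 | e with desFrom x l | ascFrom x l | length l
... | suc d | suc a | suc n = d , refl , subst (d <_) (trans (sym (+-suc d a)) (suc-injective e)) (s≤s (m≤m+n d a))

∑-zero : ∀ D → ∑ D (λ _ → 0) ≡ 0
∑-zero zero    = refl
∑-zero (suc D) = trans (+-identityʳ _) (∑-zero D)

∑-indicator : ∀ D e (g : ℕ → ℕ) → e < D → ∑ D (λ d → g d * 𝟙 (e ≡ᵇ d)) ≡ g e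
∑-indicator (suc D) zero g lt = trans (∑-suc D _) (trans
  (cong₂ _+_ (*-identityʳ (g 0)) (trans (∑-cong D (λ i _ → *-zeroʳ (g (suc i)))) (∑-zero D))) (+-identityʳ (g 0)))
∑-indicator (suc D) (suc e) g lt = trans (∑-suc D _) (trans
  (cong (_+ ∑ D (λ d → g (suc d) * 𝟙 (e ≡ᵇ d))) (*-zeroʳ (g 0))) (∑-indicator D e (g ∘ suc) (s≤s⁻¹ lt)))

total-*ˡ : ∀ {A : Set} c (f : A → ℕ) xs → c * total f xs ≡ total (λ x → c * f x) xs
total-*ˡ c f []       = *-zeroʳ c
total-*ˡ c f (x ∷ xs) = trans (*-distribˡ-+ c (f x) _) (cong (c * f x +_) (total-*ˡ c f xs))

∑-total : ∀ {A : Set} D (f : ℕ → A → ℕ) xs → ∑ D (λ d → total (f d) xs) ≡ total (λ x → ∑ D (λ d → f d x)) xs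
∑-total zero    f xs = sym (total-zero xs (λ _ → refl))
∑-total (suc D) f xs = trans (cong (_+ total (f D) xs) (∑-total D f xs)) (sym (total-+ (λ x → ∑ D (λ d → f d x)) (f D) xs))

ell-sum : ∀ j → ∑ (j ∸ 2) (λ d → 2 ^ suc d * ell j (suc d)) ≡ total (λ s → 𝟙 (first213 j s) * 2 ^ des s) (perms j)
ell-sum j = begin
  ∑ (j ∸ 2) (λ d → 2 ^ suc d * ell j (suc d))
    ≡⟨ ∑-cong (j ∸ 2) (λ d _ → trans (cong (2 ^ suc d *_) (count-total _ (perms j))) (total-*ˡ (2 ^ suc d) _ (perms j))) ⟩
  ∑ (j ∸ 2) (λ d → total (λ s → 2 ^ suc d * 𝟙 (contains213 s ∧ (descents s ≡ᵇ suc d) ∧ not (contains213 (deleteMax j s))))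
      (perms j))
    ≡⟨ ∑-total (j ∸ 2) _ (perms j) ⟩
  total (λ s → ∑ (j ∸ 2) (λ d → 2 ^ suc d * 𝟙 (contains213 s ∧ (descents s ≡ᵇ suc d) ∧ not
      (contains213 (deleteMax j s))))) (perms j)
    ≡⟨ total-cong (perms j) (λ {s} s∈ → per s (proj₁ (∈-perms⁻ {j} s∈))) ⟩
  total (λ s → 𝟙 (first213 j s) * 2 ^ des s) (perms j) ∎
  where
  open ≡-Reasoning
  all-zero : ∀ D → ∑ D (λ d → 2 ^ suc d * 0) ≡ 0
  all-zero D = trans (∑-cong D (λ d _ → *-zeroʳ (2 ^ suc d))) (∑-zero D)
  per : ∀ s → length s ≡ j → ∑ (j ∸ 2) (λ d → 2 ^ suc d * 𝟙 (contains213 s ∧ (descents s ≡ᵇ suc d) ∧ not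
      (contains213 (deleteMax j s))))
    ≡ 𝟙 (first213 j s) * 2 ^ des s
  per s refl rewrite descents≡des s with contains213 s in eq
  ... | false = all-zero (length s ∸ 2)
  ... | true with contains213 (deleteMax (length s) s)
  ...   | true  = trans (∑-cong (length s ∸ 2) (λ d _ → cong (λ c → 2 ^ suc d * 𝟙 c) (∧-zeroʳ (des s ≡ᵇ suc d))))
      (all-zero (length s ∸ 2))
  ...   | false with Has213-des-range s (contains⇒Has213 s eq)
  ...     | e , des≡ , lt rewrite des≡ = trans
    (∑-cong (length s ∸ 2) (λ d _ → cong (λ c → 2 ^ suc d * 𝟙 c) (∧-identityʳ (e ≡ᵇ d))))
    (trans (∑-indicator (length s ∸ 2) e (λ d → 2 ^ suc d) lt) (sym (+-identityʳ (2 ^ suc e))))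

-- Formal power series over ℤ

open import Data.Integer using (ℤ; +_; -[1+_]; +-*-rawRing)
open import Data.Integer using () renaming (_+_ to _+ᶻ_; _*_ to _*ᶻ_; _-_ to _-ᶻ_; -_ to -ᶻ_; _≟_ to _≟ᶻ_)
import Data.Integer.Properties as ℤₚ
import Data.Integer.Tactic.RingSolver as ℤ-Solver

infix 4 _≋_
infixl 6 _⊕_
infix 8 ⊝_

_≋_ : FPS → FPS → Set
f ≋ g = ∀ n → f n ≡ g n

_⊕_ : FPS → FPS → FPS
(f ⊕ g) n = f n +ᶻ g n

⊝_ : FPS → FPS
(⊝ f) n = -ᶻ f n

const : ℤ → FPS
const c zero    = c
const c (suc _) = + 0

scale : ℤ → FPS → FPS
scale c f n = c *ᶻ f n

⊛-zero : ∀ f g → (f ⊛ g) 0 ≡ f 0 *ᶻ g 0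
⊛-zero f g = ℤₚ.+-identityʳ _

⊛-suc : ∀ f g n → (f ⊛ g) (suc n) ≡ f 0 *ᶻ g (suc n) +ᶻ ((f ∘ suc) ⊛ g) n
⊛-suc f g n = cong (λ l → f 0 *ᶻ g (suc n) +ᶻ foldr _+ᶻ_ (+ 0) l) (begin
  map h (applyUpTo suc (suc n))  ≡⟨ map-applyUpTo suc h (suc n) ⟩
  applyUpTo (h ∘ suc) (suc n)    ≡⟨ map-upTo (h ∘ suc) (suc n) ⟨
  map (h ∘ suc) (upTo (suc n))   ∎)
  where
  open ≡-Reasoning
  h : ℕ → ℤ
  h i = f i *ᶻ g (suc n ∸ i)

⊛-cong : ∀ {f f′ g g′} → f ≋ f′ → g ≋ g′ → f ⊛ g ≋ f′ ⊛ g′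
⊛-cong {f} {f′} {g} {g′} p q zero    = trans (⊛-zero f g) (trans (cong₂ _*ᶻ_ (p 0) (q 0)) (sym (⊛-zero f′ g′)))
⊛-cong {f} {f′} {g} {g′} p q (suc n) = trans (⊛-suc f g n) (trans
  (cong₂ _+ᶻ_ (cong₂ _*ᶻ_ (p 0) (q (suc n))) (⊛-cong (p ∘ suc) q n)) (sym (⊛-suc f′ g′ n)))

-- Peels the term with the constant coefficient of `g`, as `⊛-suc` does for `f`; commutativity then
-- follows by induction, with no reversal of the sum.
⊛-sucʳ : ∀ f g n → (f ⊛ g) (suc n) ≡ f (suc n) *ᶻ g 0 +ᶻ (f ⊛ (g ∘ suc)) n
⊛-sucʳ f g zero = begin
  (f ⊛ g) 1                                        ≡⟨ ⊛-suc f g 0 ⟩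
  f 0 *ᶻ g 1 +ᶻ ((f ∘ suc) ⊛ g) 0                ≡⟨ cong₂ _+ᶻ_ (⊛-zero f (g ∘ suc)) (sym (⊛-zero (f ∘ suc) g)) ⟨
  (f ⊛ (g ∘ suc)) 0 +ᶻ f 1 *ᶻ g 0                ≡⟨ ℤₚ.+-comm ((f ⊛ (g ∘ suc)) 0) _ ⟩
  f 1 *ᶻ g 0 +ᶻ (f ⊛ (g ∘ suc)) 0                ∎
  where open ≡-Reasoning
⊛-sucʳ f g (suc n) = begin
  (f ⊛ g) (2+ n)                                   ≡⟨ ⊛-suc f g (suc n) ⟩
  a +ᶻ ((f ∘ suc) ⊛ g) (suc n)                    ≡⟨ cong (a +ᶻ_) (⊛-sucʳ (f ∘ suc) g n) ⟩
  a +ᶻ (b +ᶻ c)                                  ≡⟨ swap a b c ⟩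
  b +ᶻ (a +ᶻ c)                                  ≡⟨ cong (b +ᶻ_) (⊛-suc f (g ∘ suc) n) ⟨
  b +ᶻ (f ⊛ (g ∘ suc)) (suc n)                    ∎
  where
  open ≡-Reasoning
  a b c : ℤ
  a = f 0 *ᶻ g (2+ n)
  b = f (2+ n) *ᶻ g 0
  c = ((f ∘ suc) ⊛ (g ∘ suc)) n
  swap : ∀ x y z → x +ᶻ (y +ᶻ z) ≡ y +ᶻ (x +ᶻ z)
  swap = ℤ-Solver.solve-∀

⊛-comm : ∀ f g → f ⊛ g ≋ g ⊛ f
⊛-comm f g zero    = trans (⊛-zero f g) (trans (ℤₚ.*-comm (f 0) (g 0)) (sym (⊛-zero g f)))
⊛-comm f g (suc n) = trans (⊛-suc f g n) (trans
  (cong₂ _+ᶻ_ (ℤₚ.*-comm (f 0) (g (suc n))) (⊛-comm (f ∘ suc) g n)) (sym (⊛-sucʳ g f n)))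

⊛-distribʳ : ∀ h f g → (f ⊕ g) ⊛ h ≋ (f ⊛ h) ⊕ (g ⊛ h)
⊛-distribʳ h f g zero = trans (⊛-zero (f ⊕ g) h) (trans (ℤₚ.*-distribʳ-+ (h 0) (f 0) (g 0))
  (sym (cong₂ _+ᶻ_ (⊛-zero f h) (⊛-zero g h))))
⊛-distribʳ h f g (suc n) = begin
  ((f ⊕ g) ⊛ h) (suc n)                    ≡⟨ ⊛-suc (f ⊕ g) h n ⟩
  (f 0 +ᶻ g 0) *ᶻ h (suc n) +ᶻ (((f ∘ suc) ⊕ (g ∘ suc)) ⊛ h) n
    ≡⟨ cong ((f 0 +ᶻ g 0) *ᶻ h (suc n) +ᶻ_) (⊛-distribʳ h (f ∘ suc) (g ∘ suc) n) ⟩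
  (f 0 +ᶻ g 0) *ᶻ h (suc n) +ᶻ (((f ∘ suc) ⊛ h) n +ᶻ ((g ∘ suc) ⊛ h) n)
    ≡⟨ lem (f 0) (g 0) (h (suc n)) _ _ ⟩
  (f 0 *ᶻ h (suc n) +ᶻ ((f ∘ suc) ⊛ h) n) +ᶻ (g 0 *ᶻ h (suc n) +ᶻ ((g ∘ suc) ⊛ h) n)
    ≡⟨ cong₂ _+ᶻ_ (⊛-suc f h n) (⊛-suc g h n) ⟨
  (f ⊛ h) (suc n) +ᶻ (g ⊛ h) (suc n)      ∎
  where
  open ≡-Reasoning
  lem : ∀ a b c d e → (a +ᶻ b) *ᶻ c +ᶻ (d +ᶻ e) ≡ (a *ᶻ c +ᶻ d) +ᶻ (b *ᶻ c +ᶻ e)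
  lem = ℤ-Solver.solve-∀

⊛-distribˡ : ∀ h f g → h ⊛ (f ⊕ g) ≋ (h ⊛ f) ⊕ (h ⊛ g)
⊛-distribˡ h f g n = trans (⊛-comm h (f ⊕ g) n) (trans (⊛-distribʳ h f g n)
  (cong₂ _+ᶻ_ (⊛-comm f h n) (⊛-comm g h n)))

scale-⊛ : ∀ c f g → scale c f ⊛ g ≋ scale c (f ⊛ g)
scale-⊛ c f g zero    = trans (⊛-zero (scale c f) g) (trans (ℤₚ.*-assoc c _ _) (cong (c *ᶻ_) (sym (⊛-zero f g))))
scale-⊛ c f g (suc n) = begin
  (scale c f ⊛ g) (suc n)                           ≡⟨ ⊛-suc (scale c f) g n ⟩
  c *ᶻ f 0 *ᶻ g (suc n) +ᶻ (scale c (f ∘ suc) ⊛ g) n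
    ≡⟨ cong₂ _+ᶻ_ (ℤₚ.*-assoc c _ _) (scale-⊛ c (f ∘ suc) g n) ⟩
  c *ᶻ (f 0 *ᶻ g (suc n)) +ᶻ c *ᶻ ((f ∘ suc) ⊛ g) n
    ≡⟨ ℤₚ.*-distribˡ-+ c _ _ ⟨
  c *ᶻ (f 0 *ᶻ g (suc n) +ᶻ ((f ∘ suc) ⊛ g) n)   ≡⟨ cong (c *ᶻ_) (⊛-suc f g n) ⟨
  c *ᶻ (f ⊛ g) (suc n)                             ∎
  where open ≡-Reasoning

⊛-assoc : ∀ f g h → (f ⊛ g) ⊛ h ≋ f ⊛ (g ⊛ h)
⊛-assoc f g h zero = trans (⊛-zero (f ⊛ g) h) (trans (cong (_*ᶻ h 0) (⊛-zero f g)) (trans (ℤₚ.*-assoc (f 0) (g 0) (h 0))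
  (sym (trans (⊛-zero f (g ⊛ h)) (cong (f 0 *ᶻ_) (⊛-zero g h))))))
⊛-assoc f g h (suc n) = begin
  ((f ⊛ g) ⊛ h) (suc n)
    ≡⟨ ⊛-suc (f ⊛ g) h n ⟩
  (f ⊛ g) 0 *ᶻ h (suc n) +ᶻ (((f ⊛ g) ∘ suc) ⊛ h) n
    ≡⟨ cong₂ _+ᶻ_ (cong (_*ᶻ h (suc n)) (⊛-zero f g)) (⊛-cong {g = h} (⊛-suc f g) (λ _ → refl) n) ⟩
  f 0 *ᶻ g 0 *ᶻ h (suc n) +ᶻ ((scale (f 0) (g ∘ suc) ⊕ ((f ∘ suc) ⊛ g)) ⊛ h) n
    ≡⟨ cong (f 0 *ᶻ g 0 *ᶻ h (suc n) +ᶻ_) (⊛-distribʳ h (scale (f 0) (g ∘ suc)) ((f ∘ suc) ⊛ g) n) ⟩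
  f 0 *ᶻ g 0 *ᶻ h (suc n) +ᶻ ((scale (f 0) (g ∘ suc) ⊛ h) n +ᶻ (((f ∘ suc) ⊛ g) ⊛ h) n)
    ≡⟨ cong (f 0 *ᶻ g 0 *ᶻ h (suc n) +ᶻ_) (cong₂ _+ᶻ_ (scale-⊛ (f 0) (g ∘ suc) h n) (⊛-assoc (f ∘ suc) g h n)) ⟩
  f 0 *ᶻ g 0 *ᶻ h (suc n) +ᶻ (f 0 *ᶻ ((g ∘ suc) ⊛ h) n +ᶻ ((f ∘ suc) ⊛ (g ⊛ h)) n)
    ≡⟨ lem (f 0) (g 0) (h (suc n)) _ _ ⟩
  f 0 *ᶻ (g 0 *ᶻ h (suc n) +ᶻ ((g ∘ suc) ⊛ h) n) +ᶻ ((f ∘ suc) ⊛ (g ⊛ h)) n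
    ≡⟨ cong (λ t → f 0 *ᶻ t +ᶻ ((f ∘ suc) ⊛ (g ⊛ h)) n) (⊛-suc g h n) ⟨
  f 0 *ᶻ (g ⊛ h) (suc n) +ᶻ ((f ∘ suc) ⊛ (g ⊛ h)) n
    ≡⟨ ⊛-suc f (g ⊛ h) n ⟨
  (f ⊛ (g ⊛ h)) (suc n) ∎
  where
  open ≡-Reasoning
  lem : ∀ a b c d e → a *ᶻ b *ᶻ c +ᶻ (a *ᶻ d +ᶻ e) ≡ a *ᶻ (b *ᶻ c +ᶻ d) +ᶻ e
  lem = ℤ-Solver.solve-∀

const-⊛ : ∀ c f → const c ⊛ f ≋ scale c f
const-⊛ c f zero    = ⊛-zero (const c) f
const-⊛ c f (suc n) = trans (⊛-suc (const c) f n) (trans (cong (c *ᶻ f (suc n) +ᶻ_) (0⊛ n)) (ℤₚ.+-identityʳ _))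
  where
  0⊛ : ∀ m → ((λ _ → + 0) ⊛ f) m ≡ + 0
  0⊛ zero    = trans (⊛-zero (λ _ → + 0) f) (ℤₚ.*-zeroˡ (f 0))
  0⊛ (suc m) = trans (⊛-suc (λ _ → + 0) f m) (trans (cong₂ _+ᶻ_ (ℤₚ.*-zeroˡ (f (suc m))) (0⊛ m)) refl)

⊛-identityˡ : ∀ f → const (+ 1) ⊛ f ≋ f
⊛-identityˡ f n = trans (const-⊛ (+ 1) f n) (ℤₚ.*-identityˡ (f n))

fpsRing : CommutativeRing _ _
fpsRing = record
  { Carrier = FPS ; _≈_ = _≋_ ; _+_ = _⊕_ ; _*_ = _⊛_ ; -_ = ⊝_ ; 0# = const (+ 0) ; 1# = const (+ 1)
  ; isCommutativeRing = record
    { isRing = record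
      { +-isAbelianGroup = record
        { isGroup = record
          { isMonoid = record
            { isSemigroup = record
              { isMagma = record
                { isEquivalence = record
                  { refl = λ _ → refl ; sym = λ p n → sym (p n) ; trans = λ p q n → trans (p n) (q n) }
                ; ∙-cong = λ p q n → cong₂ _+ᶻ_ (p n) (q n) }
              ; assoc = λ f g h n → ℤₚ.+-assoc (f n) (g n) (h n) }
            ; identity = (λ f n → trans (cong (_+ᶻ f n) (0-const n)) (ℤₚ.+-identityˡ (f n)))
                       , (λ f n → trans (cong (_+ᶻ_ (f n)) (0-const n)) (ℤₚ.+-identityʳ (f n))) }
          ; inverse = (λ f n → trans (ℤₚ.+-inverseˡ (f n)) (sym (0-const n)))
                    , (λ f n → trans (ℤₚ.+-inverseʳ (f n)) (sym (0-const n)))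
          ; ⁻¹-cong = λ p n → cong -ᶻ_ (p n) }
        ; comm = λ f g n → ℤₚ.+-comm (f n) (g n) }
      ; *-cong = ⊛-cong
      ; *-assoc = ⊛-assoc
      ; *-identity = ⊛-identityˡ , (λ f n → trans (⊛-comm f (const (+ 1)) n) (⊛-identityˡ f n))
      ; distrib = ⊛-distribˡ , ⊛-distribʳ }
    ; *-comm = ⊛-comm } }
  where
  0-const : ∀ n → const (+ 0) n ≡ + 0
  0-const zero    = refl
  0-const (suc n) = refl

constHom : +-*-rawRing -Raw-AlmostCommutative⟶ fromCommutativeRing fpsRing
constHom = record
  { ⟦_⟧    = const
  ; +-homo = λ { a b zero → refl ; a b (suc n) → refl }
  ; *-homo = λ { a b zero → sym (⊛-zero (const a) (const b))
               ; a b (suc n) → sym (trans (const-⊛ a (const b) (suc n)) (ℤₚ.*-zeroʳ a)) }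
  ; -‿homo = λ { a zero → refl ; a (suc n) → refl }
  ; 0-homo = λ _ → refl
  ; 1-homo = λ _ → refl }

const≟ : ∀ a b → Maybe (const a ≋ const b)
const≟ a b with a ≟ᶻ b
... | yes refl = just (λ _ → refl)
... | no _     = nothing

module FPS-Solver = Algebra.Solver.Ring +-*-rawRing (fromCommutativeRing fpsRing) constHom const≟

-- The series of the counts F and R

X : FPS
X 1 = + 1
X _ = + 0

X⊛-zero : ∀ f → (X ⊛ f) 0 ≡ + 0
X⊛-zero f = trans (⊛-zero X f) (ℤₚ.*-zeroˡ (f 0))

X⊛-suc : ∀ f n → (X ⊛ f) (suc n) ≡ f n
X⊛-suc f n = trans (⊛-suc X f n) (trans (cong₂ _+ᶻ_ (ℤₚ.*-zeroˡ (f (suc n)))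
  (trans (⊛-cong {g = f} {g′ = f} tailX (λ _ → refl) n) (⊛-identityˡ f n))) (ℤₚ.+-identityˡ (f n)))
  where
  tailX : (X ∘ suc) ≋ const (+ 1)
  tailX zero    = refl
  tailX (suc _) = refl

Rec : (ℕ → FPS) → (ℕ → FPS) → Set
Rec b u = ∀ i → u (suc i) ≋ u i ⊕ b i ⊕ X ⊛ (u (suc (suc i)) ⊕ u (suc i))

-- `Rec` has second order in `i`, but the later indices enter with a factor X: coefficient `n` at
-- `suc i` depends on coefficient `n` at `i` and on coefficient `n - 1` elsewhere. The values at
-- index 0 therefore determine everything.
Rec-unique : ∀ b u v → Rec b u → Rec b v → u 0 ≋ v 0 → ∀ i → u i ≋ v i
Rec-unique b u v ru rv e i n = go n i
  where
  go : ∀ n i → u i n ≡ v i n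
  go n       zero    = e n
  go zero    (suc i) = trans (ru i 0) (trans
    (cong₂ _+ᶻ_ (cong (_+ᶻ b i 0) (go 0 i))
      (trans (X⊛-zero (u (suc (suc i)) ⊕ u (suc i))) (sym (X⊛-zero (v (suc (suc i)) ⊕ v (suc i))))))
    (sym (rv i 0)))
  go (suc n) (suc i) = trans (ru i (suc n)) (trans
    (cong₂ _+ᶻ_ (cong (_+ᶻ b i (suc n)) (go (suc n) i))
      (trans (X⊛-suc (u (suc (suc i)) ⊕ u (suc i)) n)
        (trans (cong₂ _+ᶻ_ (go n (suc (suc i))) (go n (suc i))) (sym (X⊛-suc (v (suc (suc i)) ⊕ v (suc i)) n)))))
    (sym (rv i (suc n))))

-- Over ℤ a nonzero constant coefficient does not make `g` invertible, as for S + T with constant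
-- coefficient 2 in `sqrt-unique`; the coefficients of `f` are killed one after another instead.
⊛-cancel-0 : ∀ f g → g 0 ≢ + 0 → f ⊛ g ≋ const (+ 0) → ∀ n → f n ≡ + 0
⊛-cancel-0 f g g≢0 e n = go f e n
  where
  head0 : ∀ f → f ⊛ g ≋ const (+ 0) → f 0 ≡ + 0
  head0 f e with ℤₚ.i*j≡0⇒i≡0∨j≡0 (f 0) (trans (sym (⊛-zero f g)) (e 0))
  ... | inj₁ p = p
  ... | inj₂ p = ⊥-elim (g≢0 p)
  tail0 : ∀ f → f ⊛ g ≋ const (+ 0) → (f ∘ suc) ⊛ g ≋ const (+ 0)
  tail0 f e n = trans (sym (ℤₚ.+-identityˡ _)) (trans
    (cong (_+ᶻ ((f ∘ suc) ⊛ g) n) (sym (trans (cong (_*ᶻ g (suc n)) (head0 f e)) (ℤₚ.*-zeroˡ (g (suc n))))))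
    (trans (sym (⊛-suc f g n)) (trans (e (suc n)) (0-const n))))
    where
    0-const : ∀ n → + 0 ≡ const (+ 0) n
    0-const zero    = refl
    0-const (suc _) = refl
  go : ∀ f → f ⊛ g ≋ const (+ 0) → ∀ n → f n ≡ + 0
  go f e zero    = head0 f e
  go f e (suc n) = go (f ∘ suc) (tail0 f e) n

open CommutativeRing fpsRing using () renaming (refl to ≋-refl; sym to ≋-sym; trans to ≋-trans; setoid to ≋-setoid)

-- l - r = c (a - b), with the terms moved so that the hypothesis is a ring identity.
substitute : ∀ {a b} c l r → a ≋ b → l ⊕ c ⊛ b ≋ r ⊕ c ⊛ a → l ≋ r
substitute {a} {b} c l r a≋b e = ∙-cancelʳ (c ⊛ b) l r
  (≋-trans e (λ n → cong (r n +ᶻ_) (⊛-cong {c} {c} (λ _ → refl) a≋b n)))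
  where open import Algebra.Properties.Group (CommutativeRing.+-group fpsRing)

⊛-cancelʳ : ∀ f g h → h 0 ≢ + 0 → f ⊛ h ≋ g ⊛ h → f ≋ g
⊛-cancelʳ f g h h≢0 e n = ℤₚ.i-j≡0⇒i≡j (f n) (g n) (⊛-cancel-0 (f ⊕ ⊝ g) h h≢0 diff n)
  where
  open FPS-Solver
  diff : (f ⊕ ⊝ g) ⊛ h ≋ const (+ 0)
  diff = substitute (const (+ 1)) _ _ e (solve 3
    (λ f g h → (f :+ (:- g)) :* h :+ con (+ 1) :* (g :* h) := con (+ 0) :+ con (+ 1) :* (f :* h)) (λ _ → refl) f g h)

Fˢ Rˢ Hˢ : ℕ → FPS
Fˢ i n = + F n i one
Rˢ i n = + R n i one
Hˢ i n = + F n i id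

Rˢ-Rec : Rec (λ _ → const (+ 0)) Rˢ
Rˢ-Rec i zero    = sym (cong (_+ᶻ_ (+ 1)) (X⊛-zero (Rˢ (suc (suc i)) ⊕ Rˢ (suc i))))
Rˢ-Rec i (suc n) = trans (lem (R (suc n) i one) (R n (suc (suc i)) one) (R n (suc i) one))
  (cong (_+ᶻ_ (Rˢ i (suc n) +ᶻ + 0)) (sym (X⊛-suc (Rˢ (suc (suc i)) ⊕ Rˢ (suc i)) n)))
  where
  lem : ∀ a b c → + (a + b + c) ≡ + a +ᶻ + 0 +ᶻ (+ b +ᶻ + c)
  lem a b c = cong +_ (ℕ-lem a b c)
    where
    ℕ-lem : ∀ a b c → a + b + c ≡ a + 0 + (b + c)
    ℕ-lem = ℕ-Solver.solve-∀

Fˢ-Rec : Rec (λ _ → const (+ 0)) Fˢ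
Fˢ-Rec i zero    = sym (cong (_+ᶻ_ (+ 1)) (X⊛-zero (Fˢ (suc (suc i)) ⊕ Fˢ (suc i))))
Fˢ-Rec i (suc n) = trans (lem (F (suc n) i one) (F n (suc (suc i)) one) (F n (suc i) one))
  (cong (_+ᶻ_ (Fˢ i (suc n) +ᶻ + 0)) (sym (X⊛-suc (Fˢ (suc (suc i)) ⊕ Fˢ (suc i)) n)))
  where
  lem : ∀ a b c → + (a + b + c) ≡ + a +ᶻ + 0 +ᶻ (+ b +ᶻ + c)
  lem a b c = cong +_ (ℕ-lem a b c)
    where
    ℕ-lem : ∀ a b c → a + b + c ≡ a + 0 + (b + c)
    ℕ-lem = ℕ-Solver.solve-∀

-- The forcing term records the block that was just opened: `F` with weight `suc` is `F` with `id`
-- plus `F` with `one`.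
Hˢ-Rec : Rec (λ i → X ⊛ Fˢ (suc (suc i))) Hˢ
Hˢ-Rec i zero    = sym (cong₂ _+ᶻ_ (X⊛-zero (Fˢ (suc (suc i)))) (X⊛-zero (Hˢ (suc (suc i)) ⊕ Hˢ (suc i))))
Hˢ-Rec i (suc n) = trans (cong +_ (cong (λ t → F (suc n) i id + t + F n (suc i) id) (F-blocks-suc n (suc (suc i)))))
  (trans (cong +_ (lem (F (suc n) i id) (F n (suc (suc i)) id) (F n (suc (suc i)) one) (F n (suc i) id)))
  (cong₂ _+ᶻ_ (cong (_+ᶻ_ (Hˢ i (suc n))) (sym (X⊛-suc (Fˢ (suc (suc i))) n)))
      (sym (X⊛-suc (Hˢ (suc (suc i)) ⊕ Hˢ (suc i)) n))))
  where
  lem : ∀ a b c d → a + (b + c) + d ≡ a + c + (b + d)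
  lem = ℕ-Solver.solve-∀

Rˢ-zero : Rˢ 0 ≋ const (+ 1)
Rˢ-zero zero    = refl
Rˢ-zero (suc n) = refl

Fˢ-zero : Fˢ 0 ≋ const (+ 1) ⊕ X ⊛ Fˢ 1
Fˢ-zero zero    = sym (cong (_+ᶻ_ (+ 1)) (X⊛-zero (Fˢ 1)))
Fˢ-zero (suc n) = sym (trans (ℤₚ.+-identityˡ _) (X⊛-suc (Fˢ 1) n))

Hˢ-zero : Hˢ 0 ≋ X ⊛ (Hˢ 1 ⊕ Fˢ 1)
Hˢ-zero zero    = sym (X⊛-zero (Hˢ 1 ⊕ Fˢ 1))
Hˢ-zero (suc n) = trans (cong +_ (F-blocks-suc n 1)) (sym (X⊛-suc (Hˢ 1 ⊕ Fˢ 1) n))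

ρ 𝒜 : FPS
ρ = Rˢ 1
𝒜 = Fˢ 0

⊛-Rec : ∀ u g → Rec (λ _ → const (+ 0)) u → Rec (λ _ → const (+ 0)) (λ i → u i ⊛ g)
⊛-Rec u g ru i = ≋-trans (⊛-cong {g = g} (ru i) ≋-refl) (solve 5
  (λ x a b c g → (a :+ con (+ 0) :+ x :* (b :+ c)) :* g := a :* g :+ con (+ 0) :+ x :* (b :* g :+ c :* g)) ≋-refl
  X (u i) (u (suc (suc i))) (u (suc i)) g)
  where open FPS-Solver

-- The homogeneous recursion is invariant under shifts of the index and under multiplication by a
-- fixed series, so both sides solve it and agree at `i = 0`. Hence `Rˢ i` is ρ^i.
Rˢ-mul : ∀ i j → Rˢ (i + j) ≋ Rˢ i ⊛ Rˢ j
Rˢ-mul i j = Rec-unique _ (λ i → Rˢ (i + j)) (λ i → Rˢ i ⊛ Rˢ j) (λ i → Rˢ-Rec (i + j)) (⊛-Rec Rˢ (Rˢ j) Rˢ-Rec)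
  (≋-sym (≋-trans (⊛-cong {g = Rˢ j} Rˢ-zero ≋-refl) (⊛-identityˡ (Rˢ j)))) i

Fˢ-geometric : ∀ i → Fˢ i ≋ Rˢ i ⊛ 𝒜
Fˢ-geometric = Rec-unique (λ _ → const (+ 0)) Fˢ (λ i → Rˢ i ⊛ 𝒜) Fˢ-Rec (⊛-Rec Rˢ 𝒜 Rˢ-Rec)
    (≋-sym (≋-trans (⊛-cong {g = 𝒜} Rˢ-zero ≋-refl) (⊛-identityˡ 𝒜)))

ρ-eq : ρ ≋ const (+ 1) ⊕ X ⊛ (ρ ⊛ ρ ⊕ ρ)
ρ-eq = ≋-trans (Rˢ-Rec 0) (λ n → cong₂ _+ᶻ_ (trans (cong (_+ᶻ const (+ 0) n) (Rˢ-zero n)) (lem n))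
  (⊛-cong {X} {X} ≋-refl (λ k → cong (_+ᶻ ρ k) (Rˢ-mul 1 1 k)) n))
  where
  lem : ∀ n → const (+ 1) n +ᶻ const (+ 0) n ≡ const (+ 1) n
  lem zero    = refl
  lem (suc n) = refl

𝒜-eq : 𝒜 ≋ const (+ 1) ⊕ X ⊛ (ρ ⊛ 𝒜)
𝒜-eq = ≋-trans Fˢ-zero (λ n → cong (const (+ 1) n +ᶻ_) (⊛-cong {X} {X} ≋-refl (Fˢ-geometric 1) n))

-- By `ρ-eq`, (1 + ρ)(1 - Xρ) = 2, while `𝒜-eq` says 𝒜(1 - Xρ) = 1.
two-𝒜 : const (+ 2) ⊛ 𝒜 ≋ const (+ 1) ⊕ ρ
two-𝒜 = substitute (const (+ 1) ⊕ ρ) _ _ 𝒜-eq (substitute 𝒜 _ _ (≋-sym ρ-eq) (solve 3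
  (λ x ρ c → con (+ 2) :* c :+ (con (+ 1) :+ ρ) :* (con (+ 1) :+ x :* (ρ :* c)) :+ c :* ρ
    := (con (+ 1) :+ ρ :+ (con (+ 1) :+ ρ) :* c) :+ c :* (con (+ 1) :+ x :* (ρ :* ρ :+ ρ))) ≋-refl X ρ 𝒜))
  where open FPS-Solver

⊛-congʳ : ∀ g {a b} → a ≋ b → g ⊛ a ≋ g ⊛ b
⊛-congʳ g e = ⊛-cong {g} {g} ≋-refl e

⊕-cong : ∀ {a b c d} → a ≋ b → c ≋ d → a ⊕ c ≋ b ⊕ d
⊕-cong p q n = cong₂ _+ᶻ_ (p n) (q n)

-- `D` comes from the resonance: the sequence i ρ^i, inserted into u(i+1) - u(i) - X(u(i+2) +
-- u(i+1)), leaves D ρ^i. By `ρ-eq`, S₀ ρ = D.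
D S₀ : FPS
D = const (+ 1) ⊕ ⊝ (X ⊛ (ρ ⊛ ρ))
S₀ = const (+ 1) ⊕ ⊝ X ⊕ ⊝ (const (+ 2) ⊛ (X ⊛ ρ))

-- A homogeneous part `Hˢ 0` ρ^i plus the resonant part, which is i ρ^i times X𝒜ρ² divided by `D`;
-- multiplying through by `D` keeps everything a ring identity.
Hˢ-solution : ∀ i → D ⊛ Hˢ i ≋ D ⊛ (Hˢ 0 ⊛ Rˢ i) ⊕ const (+ i) ⊛ (X ⊛ (𝒜 ⊛ ((ρ ⊛ ρ) ⊛ Rˢ i)))
Hˢ-solution = Rec-unique (λ i → D ⊛ (X ⊛ Fˢ (suc (suc i)))) (λ i → D ⊛ Hˢ i) v
  (λ i → ≋-trans (⊛-congʳ D (Hˢ-Rec i)) (solve 6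
    (λ d x h₀ fi h₂ h₁ → d :* (h₀ :+ x :* fi :+ x :* (h₂ :+ h₁)) := d :* h₀ :+ d :* (x :* fi) :+ x :* (d :* h₂ :+ d :* h₁))
    ≋-refl D X (Hˢ i) (Fˢ (suc (suc i))) (Hˢ (suc (suc i))) (Hˢ (suc i))))
  v-Rec
  (≋-sym (≋-trans (⊕-cong {c = const (+ 0) ⊛ (X ⊛ (𝒜 ⊛ ((ρ ⊛ ρ) ⊛ Rˢ 0)))} (⊛-congʳ D (⊛-congʳ (Hˢ 0) Rˢ-zero)) ≋-refl)
      (solve 5
    (λ d h x c r → d :* (h :* con (+ 1)) :+ con (+ 0) :* (x :* (c :* r)) := d :* h) ≋-refl D (Hˢ 0) X 𝒜 ((ρ ⊛ ρ) ⊛ Rˢ 0))))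
  where
  open FPS-Solver
  v : ℕ → FPS
  v i = D ⊛ (Hˢ 0 ⊛ Rˢ i) ⊕ const (+ i) ⊛ (X ⊛ (𝒜 ⊛ ((ρ ⊛ ρ) ⊛ Rˢ i)))
  vᵖ : ∀ i k rk → Rˢ (k + i) ≋ rk ⊛ Rˢ i → v (k + i) ≋ D ⊛ (Hˢ 0 ⊛ (rk ⊛ Rˢ i)) ⊕ (const (+ k) ⊕ const (+ i)) ⊛
      (X ⊛ (𝒜 ⊛ ((ρ ⊛ ρ) ⊛ (rk ⊛ Rˢ i))))
  vᵖ i k rk e = ⊕-cong (⊛-congʳ D (⊛-congʳ (Hˢ 0) e))
    (⊛-cong {g = X ⊛ (𝒜 ⊛ ((ρ ⊛ ρ) ⊛ Rˢ (k + i)))} (const-+ k i) (⊛-congʳ X (⊛-congʳ 𝒜 (⊛-congʳ (ρ ⊛ ρ) e))))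
    where
    const-+ : ∀ a b → const (+ (a + b)) ≋ const (+ a) ⊕ const (+ b)
    const-+ a b zero    = refl
    const-+ a b (suc n) = refl
  r₂ : ∀ i → Rˢ (suc (suc i)) ≋ (ρ ⊛ ρ) ⊛ Rˢ i
  r₂ i = ≋-trans (Rˢ-mul 2 i) (⊛-cong {g = Rˢ i} (Rˢ-mul 1 1) ≋-refl)
  v-Rec : Rec (λ i → D ⊛ (X ⊛ Fˢ (suc (suc i)))) v
  v-Rec i = ≋-trans (vᵖ i 1 ρ (Rˢ-mul 1 i)) (≋-trans (substitute (K) _ _ ρ-eq (solve 6
    (λ x ρ c h i r → let d = con (+ 1) :+ (:- (x :* (ρ :* ρ)))
                         V = λ k ρᵏ → d :* (h :* (ρᵏ :* r)) :+ (k :+ i) :* (x :* (c :* ((ρ :* ρ) :* (ρᵏ :* r))))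
                         kk = d :* (h :* r) :+ (con (+ 1) :+ i) :* (x :* (c :* ((ρ :* ρ) :* r))) in
      V (con (+ 1)) ρ :+ kk :* (con (+ 1) :+ x :* (ρ :* ρ :+ ρ))
      := (d :* (h :* r) :+ i :* (x :* (c :* ((ρ :* ρ) :* r)))) :+ d :* (x :* (((ρ :* ρ) :* r) :* c)) :+ x :*
          (V (con (+ 2)) (ρ :* ρ) :+ V (con (+ 1)) ρ) :+ kk :* ρ) ≋-refl X ρ 𝒜 (Hˢ 0) (const (+ i)) (Rˢ i)))
    (≋-sym (⊕-cong (⊕-cong {v i} ≋-refl (⊛-congʳ D (⊛-congʳ X
        (≋-trans (Fˢ-geometric (suc (suc i))) (⊛-cong {g = 𝒜} (r₂ i) ≋-refl)))))
      (⊛-congʳ X (⊕-cong (vᵖ i 2 (ρ ⊛ ρ) (r₂ i)) (vᵖ i 1 ρ (Rˢ-mul 1 i)))))))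
    where
    K : FPS
    K = D ⊛ (Hˢ 0 ⊛ Rˢ i) ⊕ (const (+ 1) ⊕ const (+ i)) ⊛ (X ⊛ (𝒜 ⊛ ((ρ ⊛ ρ) ⊛ Rˢ i)))

-- The boundary equation `Hˢ-zero` closes the system: with `Hˢ 1` expressed through `Hˢ 0`, only one
-- unknown is left.
Hˢ-fixpoint : D ⊛ Hˢ 0 ≋ X ⊛ (ρ ⊛ (D ⊛ Hˢ 0)) ⊕ X ⊛ (ρ ⊛ 𝒜)
Hˢ-fixpoint = substitute D _ _ Hˢ-zero (substitute (X ⊛ D) _ _ (Fˢ-geometric 1) (substitute X _ _ (Hˢ-solution 1) (solve 6
  (λ x ρ c h₀ h₁ f₁ → let d = con (+ 1) :+ (:- (x :* (ρ :* ρ))) in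
    d :* h₀ :+ d :* (x :* (h₁ :+ f₁)) :+ (x :* d) :* (ρ :* c) :+ x :*
        (d :* (h₀ :* ρ) :+ con (+ 1) :* (x :* (c :* ((ρ :* ρ) :* ρ))))
    := x :* (ρ :* (d :* h₀)) :+ x :* (ρ :* c) :+ d :* h₀ :+ (x :* d) :* f₁ :+ x :* (d :* h₁)) ≋-refl X ρ 𝒜 (Hˢ 0) (Hˢ 1)
        (Fˢ 1))))
  where open FPS-Solver

-- Multiplying `Hˢ-fixpoint` by 𝒜 and using 𝒜(1 - Xρ) = 1 gives D `Hˢ 0` = Xρ𝒜². Since S₀ ρ = D, a
-- factor ρ cancels.
Hˢ-S₀ : Hˢ 0 ⊛ S₀ ≋ X ⊛ (𝒜 ⊛ 𝒜)
Hˢ-S₀ = ⊛-cancelʳ (Hˢ 0 ⊛ S₀) (X ⊛ (𝒜 ⊛ 𝒜)) ρ (λ ())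
  (substitute (Hˢ 0) _ _ ρ-eq (substitute (D ⊛ Hˢ 0) _ _ (≋-sym 𝒜-eq) (substitute 𝒜 _ _ Hˢ-fixpoint (solve 4
  (λ x ρ c h → let d = con (+ 1) :+ (:- (x :* (ρ :* ρ)))
                   s = con (+ 1) :+ (:- x) :+ (:- (con (+ 2) :* (x :* ρ))) in
    (h :* s) :* ρ :+ h :* (con (+ 1) :+ x :* (ρ :* ρ :+ ρ)) :+ (d :* h) :* c :+ c :* (x :* (ρ :* (d :* h)) :+ x :* (ρ :* c))
    := (x :* (c :* c)) :* ρ :+ h :* ρ :+ (d :* h) :* (con (+ 1) :+ x :* (ρ :* c)) :+ c :* (d :* h)) ≋-refl X ρ 𝒜 (Hˢ 0)))))
  where open FPS-Solver

-- Completing the square in Xρ² + (X - 1)ρ + 1 = 0; the discriminant is (1 - X)² - 4X.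
S₀-square : S₀ ⊛ S₀ ≋ const (+ 1) ⊕ const (-[1+ 5 ]) ⊛ X ⊕ X ⊛ X
S₀-square = substitute (const (-[1+ 3 ]) ⊛ X) _ _ ρ-eq (solve 2
  (λ x ρ → let s = con (+ 1) :+ (:- x) :+ (:- (con (+ 2) :* (x :* ρ))) in
    s :* s :+ (con (-[1+ 3 ]) :* x) :* (con (+ 1) :+ x :* (ρ :* ρ :+ ρ))
    := con (+ 1) :+ con (-[1+ 5 ]) :* x :+ x :* x :+ (con (-[1+ 3 ]) :* x) :* ρ) ≋-refl X ρ)
  where open FPS-Solver

-- S - T is killed by S + T. The normalization S(0) = T(0) = 1 rules out S = -T.
sqrt-unique : ∀ S T → S 0 ≡ + 1 → T 0 ≡ + 1 → S ⊛ S ≋ T ⊛ T → S ≋ T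
sqrt-unique S T s₀ t₀ e = ⊛-cancelʳ S T (S ⊕ T) (λ p → contra (trans (sym (cong₂ _+ᶻ_ s₀ t₀)) p))
  (substitute (const (+ 1)) _ _ e (solve 2
    (λ s t → s :* (s :+ t) :+ con (+ 1) :* (t :* t) := t :* (s :+ t) :+ con (+ 1) :* (s :* s)) ≋-refl S T))
  where
  open FPS-Solver
  contra : + 2 ≢ + 0
  contra ()

linear : ∀ a b → poly (a ∷ b ∷ []) ≋ const a ⊕ const b ⊛ X
linear a b zero          = trans (sym (ℤₚ.+-identityʳ a)) (cong (a +ᶻ_) (sym (trans (const-⊛ b X 0) (ℤₚ.*-zeroʳ b))))
linear a b (suc zero)    = sym (trans (ℤₚ.+-identityˡ _) (trans (const-⊛ b X 1) (ℤₚ.*-identityʳ b)))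
linear a b (suc (suc n)) = sym (trans (ℤₚ.+-identityˡ _) (trans (const-⊛ b X (suc (suc n))) (ℤₚ.*-zeroʳ b)))

quadratic : ∀ a b → poly (a ∷ b ∷ + 1 ∷ []) ≋ const a ⊕ const b ⊛ X ⊕ X ⊛ X
quadratic a b n = trans (split n) (cong (_+ᶻ (X ⊛ X) n) (linear a b n))
  where
  split : poly (a ∷ b ∷ + 1 ∷ []) ≋ poly (a ∷ b ∷ []) ⊕ X ⊛ X
  split zero                = sym (trans (cong (a +ᶻ_) (X⊛-zero X)) (ℤₚ.+-identityʳ a))
  split (suc zero)          = sym (trans (cong (b +ᶻ_) (X⊛-suc X 0)) (ℤₚ.+-identityʳ b))
  split (suc (suc zero))    = sym (trans (ℤₚ.+-identityˡ _) (X⊛-suc X 1))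
  split (suc (suc (suc n))) = sym (trans (ℤₚ.+-identityˡ _) (X⊛-suc X (suc (suc n))))

-- `W` starts at degree 1, so the `const (+ 1)` stands in for the missing value w 0 = 1.
leaf-series : ∀ W → W 0 ≡ + 0 → W 1 ≡ + 1 → (∀ n → W (suc (suc n)) ≡ W (suc n) +ᶻ + 2 *ᶻ Hˢ 0 (suc n)) →
  W ≋ X ⊛ (W ⊕ const (+ 1) ⊕ const (+ 2) ⊛ Hˢ 0)
leaf-series W e₀ e₁ step zero = trans e₀ (sym (X⊛-zero (W ⊕ const (+ 1) ⊕ const (+ 2) ⊛ Hˢ 0)))
leaf-series W e₀ e₁ step (suc n) = trans (go n) (sym (X⊛-suc (W ⊕ const (+ 1) ⊕ const (+ 2) ⊛ Hˢ 0) n))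
  where
  go : ∀ n → W (suc n) ≡ W n +ᶻ const (+ 1) n +ᶻ (const (+ 2) ⊛ Hˢ 0) n
  go zero    = trans e₁ (sym (cong₂ _+ᶻ_ (cong (_+ᶻ + 1) e₀) (const-⊛ (+ 2) (Hˢ 0) 0)))
  go (suc n) = trans (step n) (sym (cong₂ _+ᶻ_ (ℤₚ.+-identityʳ (W (suc n))) (const-⊛ (+ 2) (Hˢ 0) (suc n))))

-- Clearing 1 - X and S₀ leaves 4XS₀ + 8X²𝒜² on the left. Here 4𝒜² = (1 + ρ)² and 2X(1 + ρ) = 1 + X
-- - S₀, so the square of S₀ makes the rest linear in S₀.
generating-function : ∀ W → W ≋ X ⊛ (W ⊕ const (+ 1) ⊕ const (+ 2) ⊛ Hˢ 0) →
  ∀ S → S 0 ≡ + 1 → S ⊛ S ≋ poly (+ 1 ∷ -[1+ 5 ] ∷ + 1 ∷ []) →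
  (poly (+ 4 ∷ -[1+ 3 ] ∷ []) ⊛ S) ⊛ W ≋ poly (+ 1 ∷ -[1+ 1 ] ∷ + 1 ∷ []) ⊕ ⊝ (poly (+ 1 ∷ -[1+ 2 ] ∷ []) ⊛ S)
generating-function W W-eq S s₀ S² = ≋-trans
  (⊛-cong {g = W} (⊛-cong (linear (+ 4) -[1+ 3 ]) S≋S₀) ≋-refl)
  (≋-trans closed (≋-sym (⊕-cong (quadratic (+ 1) -[1+ 1 ])
    (λ n → cong -ᶻ_ (⊛-cong (linear (+ 1) -[1+ 2 ]) S≋S₀ n)))))
  where
  open FPS-Solver
  S≋S₀ : S ≋ S₀
  S≋S₀ = sqrt-unique S S₀ s₀ refl (≋-trans S² (≋-trans (quadratic (+ 1) -[1+ 5 ]) (≋-sym S₀-square)))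
  four-𝒜² : const (+ 4) ⊛ (𝒜 ⊛ 𝒜) ≋ (const (+ 1) ⊕ ρ) ⊛ (const (+ 1) ⊕ ρ)
  four-𝒜² = ≋-trans (solve 1 (λ c → con (+ 4) :* (c :* c) := (con (+ 2) :* c) :* (con (+ 2) :* c)) ≋-refl 𝒜)
    (⊛-cong two-𝒜 two-𝒜)
  closed : ((const (+ 4) ⊕ const (-[1+ 3 ]) ⊛ X) ⊛ S₀) ⊛ W
    ≋ (const (+ 1) ⊕ const (-[1+ 1 ]) ⊛ X ⊕ X ⊛ X) ⊕ ⊝ ((const (+ 1) ⊕ const (-[1+ 2 ]) ⊛ X) ⊛ S₀)
  closed = substitute (const (+ 4) ⊛ S₀) _ _ W-eq (substitute (const (+ 8) ⊛ X) _ _ Hˢ-S₀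
    (substitute (const (+ 2) ⊛ (X ⊛ X)) _ _ four-𝒜² (substitute (const (+ 2) ⊛ X) _ _ (≋-sym ρ-eq) (solve 5
    (λ x ρ c h w → let s = con (+ 1) :+ (:- x) :+ (:- (con (+ 2) :* (x :* ρ))) in
      ((con (+ 4) :+ con (-[1+ 3 ]) :* x) :* s) :* w
        :+ (con (+ 4) :* s) :* (x :* (w :+ con (+ 1) :+ con (+ 2) :* h))
        :+ (con (+ 8) :* x) :* (x :* (c :* c))
        :+ (con (+ 2) :* (x :* x)) :* ((con (+ 1) :+ ρ) :* (con (+ 1) :+ ρ))
        :+ (con (+ 2) :* x) :* ρ
      := (con (+ 1) :+ con (-[1+ 1 ]) :* x :+ x :* x) :+ (:- ((con (+ 1) :+ con (-[1+ 2 ]) :* x) :* s))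
        :+ (con (+ 4) :* s) :* w
        :+ (con (+ 8) :* x) :* (h :* s)
        :+ (con (+ 2) :* (x :* x)) :* (con (+ 4) :* (c :* c))
        :+ (con (+ 2) :* x) :* (con (+ 1) :+ x :* (ρ :* ρ :+ ρ))) ≋-refl X ρ 𝒜 (Hˢ 0) W))))

-- Narayana numbers

∑ᶻ : ℕ → (ℕ → ℤ) → ℤ
∑ᶻ zero    f = + 0
∑ᶻ (suc n) f = f 0 +ᶻ ∑ᶻ n (f ∘ suc)

-- _C-1_ n d is n choose (d − 1).
_C-1_ : ℕ → ℕ → ℕ
n C-1 zero  = 0
n C-1 suc d = n C d

nC0≡1 : ∀ n → n C 0 ≡ 1
nC0≡1 zero    = refl
nC0≡1 (suc n) = refl

C-1-pascal : ∀ n d → suc n C d ≡ n C d + n C-1 d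
C-1-pascal n zero    = trans (nC0≡1 (suc n)) (sym (trans (+-identityʳ _) (nC0≡1 n)))
C-1-pascal n (suc d) = trans (sym (nCk+nC[k+1]≡[n+1]C[k+1] n d)) (+-comm (n C d) _)

-- Lagrange inversion for the series Fˢ i suggests ((m + i) C d) * (i * (m C d) + m C (d + 1)) / (m + i); the
-- equivalent 2 × 2 determinant avoids the division and satisfies the recursion of F by Pascal's rule alone.
refined : ℕ → ℕ → ℕ → ℤ
refined m i d = + ((m + i) C d) *ᶻ + (m C d) -ᶻ + (pred (m + i) C-1 d) *ᶻ + (suc m C suc d)

refined-suc-zero : ∀ m d → refined (suc m) 0 d ≡ refined m 1 d
refined-suc-zero m d rewrite +-identityʳ m | +-comm m 1 = trans
  (cong₂ (λ a b → + (suc m C d) *ᶻ + a -ᶻ + (m C-1 d) *ᶻ + b)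
    (C-1-pascal m d) (C-1-pascal (suc m) (suc d)))
  (lem (+ (suc m C d)) (+ (m C d)) (+ (m C-1 d)) (+ (suc m C suc d)))
  where
  lem : ∀ a b c e → a *ᶻ (b +ᶻ c) -ᶻ c *ᶻ (e +ᶻ a) ≡ a *ᶻ b -ᶻ c *ᶻ e
  lem = ℤ-Solver.solve-∀

refined-zero : ∀ m i → refined m i 0 ≡ + 1
refined-zero m i = trans (cong₂ (λ a b → + a *ᶻ + b -ᶻ + 0) (nC0≡1 (m + i)) (nC0≡1 m)) refl

-- This is `F-run-step` with the descents marked and differenced in `i`: the child at the end of the
-- run moves from `suc i` to `suc (suc i)`, and a new child with one more descent appears.
refined-step : ∀ m i d → refined (suc m) (suc i) (suc d) ≡
  refined (suc m) i (suc d) +ᶻ refined m (suc (suc i)) (suc d) -ᶻ refined m (suc i) (suc d) +ᶻ refined m (suc i) d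
refined-step m i d rewrite +-suc m (suc i) | +-suc m i
  | C-1-pascal (suc (m + i)) (suc d) | C-1-pascal (m + i) (suc d) | C-1-pascal (m + i) d
  | C-1-pascal (suc m) (suc (suc d)) | C-1-pascal m (suc d)
  = lem (+ ((m + i) C suc d)) (+ ((m + i) C d)) (+ ((m + i) C-1 d)) (+ (m C d)) (+ (m C suc d)) (+ (suc m C suc (suc d)))
  where
  lem : ∀ o q b s t u → ((o +ᶻ q) +ᶻ (q +ᶻ b)) *ᶻ (t +ᶻ s) -ᶻ (q +ᶻ b) *ᶻ (u +ᶻ (t +ᶻ s))
    ≡ (o +ᶻ q) *ᶻ (t +ᶻ s) -ᶻ q *ᶻ (u +ᶻ (t +ᶻ s)) +ᶻ (((o +ᶻ q) +ᶻ (q +ᶻ b)) *ᶻ t -ᶻ (q +ᶻ b) *ᶻ u)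
      -ᶻ ((o +ᶻ q) *ᶻ t -ᶻ q *ᶻ u) +ᶻ ((q +ᶻ b) *ᶻ s -ᶻ b *ᶻ (t +ᶻ s))
  lem = ℤ-Solver.solve-∀

∑ᶻ-cong : ∀ n {f g} → (∀ i → f i ≡ g i) → ∑ᶻ n f ≡ ∑ᶻ n g
∑ᶻ-cong zero    e = refl
∑ᶻ-cong (suc n) e = cong₂ _+ᶻ_ (e 0) (∑ᶻ-cong n (e ∘ suc))

∑ᶻ-zero : ∀ n {f} → (∀ i → f i ≡ + 0) → ∑ᶻ n f ≡ + 0
∑ᶻ-zero zero    e = refl
∑ᶻ-zero (suc n) e = cong₂ _+ᶻ_ (e 0) (∑ᶻ-zero n (e ∘ suc))

∑ᶻ-combine : ∀ n f g h k → ∑ᶻ n (λ i → f i +ᶻ g i -ᶻ h i +ᶻ k i) ≡ ∑ᶻ n f +ᶻ ∑ᶻ n g -ᶻ ∑ᶻ n h +ᶻ ∑ᶻ n k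
∑ᶻ-combine zero    f g h k = refl
∑ᶻ-combine (suc n) f g h k = trans
  (cong ((f 0 +ᶻ g 0 -ᶻ h 0 +ᶻ k 0) +ᶻ_) (∑ᶻ-combine n (f ∘ suc) (g ∘ suc) (h ∘ suc) (k ∘ suc)))
  (lem (f 0) (g 0) (h 0) (k 0) _ _ _ _)
  where
  lem : ∀ a b c d a′ b′ c′ d′ → (a +ᶻ b -ᶻ c +ᶻ d) +ᶻ (a′ +ᶻ b′ -ᶻ c′ +ᶻ d′)
    ≡ (a +ᶻ a′) +ᶻ (b +ᶻ b′) -ᶻ (c +ᶻ c′) +ᶻ (d +ᶻ d′)
  lem = ℤ-Solver.solve-∀

∑ᶻ-double : ∀ n f → ∑ᶻ n (λ i → + 2 *ᶻ f i) ≡ + 2 *ᶻ ∑ᶻ n f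
∑ᶻ-double zero    f = refl
∑ᶻ-double (suc n) f = trans (cong (+ 2 *ᶻ f 0 +ᶻ_) (∑ᶻ-double n (f ∘ suc))) (sym (ℤₚ.*-distribˡ-+ (+ 2) (f 0) _))

∑ᶻ-∑ : ∀ n (f : ℕ → ℕ) → ∑ᶻ n (λ d → + f d) ≡ + ∑ n f
∑ᶻ-∑ n f = go n f
  where
  split : ∀ n (f : ℕ → ℕ) → f 0 + ∑ n (f ∘ suc) ≡ ∑ (suc n) f
  split zero    f = +-identityʳ (f 0)
  split (suc n) f = trans (sym (+-assoc (f 0) _ _)) (cong (_+ f (suc n)) (split n f))
  go : ∀ n f → ∑ᶻ n (λ d → + f d) ≡ + ∑ n f
  go zero    f = refl
  go (suc n) f = trans (cong (+ f 0 +ᶻ_) (go n (f ∘ suc))) (cong +_ (split n f))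

weighted : ℕ → ℕ → ℕ → ℤ
weighted m i d = + (2 ^ d) *ᶻ refined m i d

weighted-step : ∀ m i N → ∑ᶻ (suc N) (weighted (suc m) (suc i)) ≡
  ∑ᶻ (suc N) (weighted (suc m) i) +ᶻ ∑ᶻ (suc N) (weighted m (suc (suc i)))
  -ᶻ ∑ᶻ (suc N) (weighted m (suc i)) +ᶻ + 2 *ᶻ ∑ᶻ N (weighted m (suc i))
weighted-step m i N = trans
  (cong₂ _+ᶻ_ (trans (w₀ (suc m) (suc i)) (sym (cong₂ _-ᶻ_ (cong₂ _+ᶻ_ (w₀ (suc m) i) (w₀ m (suc (suc i)))) (w₀ m (suc i)))))
    (trans (∑ᶻ-cong N (λ d → trans (cong (+ (2 ^ suc d) *ᶻ_) (refined-step m i d)) (trans (distr (+ (2 ^ suc d)) _ _ _ _)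
        (cong (λ t → weighted (suc m) i (suc d) +ᶻ weighted m (suc (suc i)) (suc d) -ᶻ weighted m (suc i) (suc d) +ᶻ t)
          (trans (cong (_*ᶻ refined m (suc i) d) (ℤₚ.pos-* 2 (2 ^ d))) (ℤₚ.*-assoc (+ 2) (+ (2 ^ d)) _))))))
      (trans (∑ᶻ-combine N _ _ _ _) (cong (s₁ +ᶻ s₂ -ᶻ s₃ +ᶻ_) (∑ᶻ-double N (weighted m (suc i)))))))
  (lem (weighted (suc m) i 0) (weighted m (suc (suc i)) 0) (weighted m (suc i) 0) s₁ s₂ s₃ _)
  where
  w₀ : ∀ m i → weighted m i 0 ≡ + 1
  w₀ m i = cong (+ 1 *ᶻ_) (refined-zero m i)
  s₁ s₂ s₃ : ℤ
  s₁ = ∑ᶻ N (weighted (suc m) i ∘ suc)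
  s₂ = ∑ᶻ N (weighted m (suc (suc i)) ∘ suc)
  s₃ = ∑ᶻ N (weighted m (suc i) ∘ suc)
  distr : ∀ p a b c d → p *ᶻ (a +ᶻ b -ᶻ c +ᶻ d) ≡ p *ᶻ a +ᶻ p *ᶻ b -ᶻ p *ᶻ c +ᶻ p *ᶻ d
  distr = ℤ-Solver.solve-∀
  lem : ∀ a b c a′ b′ c′ d → (a +ᶻ b -ᶻ c) +ᶻ (a′ +ᶻ b′ -ᶻ c′ +ᶻ d) ≡ (a +ᶻ a′) +ᶻ (b +ᶻ b′) -ᶻ (c +ᶻ c′) +ᶻ d
  lem = ℤ-Solver.solve-∀

-- At most `m` descents can be added, so any `N > m` bounds the sum. The weight 2^d turns the last
-- two terms of `refined-step` into -c + 2c = c, the last term in the recursion of `F`.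
F-refined : ∀ m i N → m < N → ∑ᶻ N (weighted m i) ≡ + F m i one
F-refined zero    i (suc N) _ = cong₂ _+ᶻ_ (cong (+ 1 *ᶻ_) (refined-zero 0 i)) (∑ᶻ-zero N (λ d →
  trans (cong (+ (2 ^ suc d) *ᶻ_) (cong₂ _-ᶻ_
    (trans (cong (λ t → + (i C suc d) *ᶻ + t) (k>n⇒nCk≡0 {0} {suc d} z<s)) (ℤₚ.*-zeroʳ (+ (i C suc d))))
    (trans (cong (λ t → + (pred i C d) *ᶻ + t) (k>n⇒nCk≡0 {1} {suc (suc d)} (s<s z<s))) (ℤₚ.*-zeroʳ (+ (pred i C d))))))
    (ℤₚ.*-zeroʳ (+ (2 ^ suc d)))))
F-refined (suc m) zero    N       m<N = trans (∑ᶻ-cong N (λ d → cong (+ (2 ^ d) *ᶻ_) (refined-suc-zero m d)))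
  (F-refined m 1 N (<-trans (n<1+n m) m<N))
F-refined (suc m) (suc i) (suc N) m<N = trans (weighted-step m i N) (trans
  (cong₂ _+ᶻ_ (cong₂ _-ᶻ_ (cong₂ _+ᶻ_ (F-refined (suc m) i (suc N) m<N) (F-refined m (suc (suc i)) (suc N) m<N′))
      (F-refined m (suc i) (suc N) m<N′))
    (cong (+ 2 *ᶻ_) (F-refined m (suc i) N (s<s⁻¹ m<N))))
  (lem (+ F (suc m) i one) (+ F m (suc (suc i)) one) (+ F m (suc i) one)))
  where
  m<N′ : m < suc N
  m<N′ = <-trans (n<1+n m) m<N
  lem : ∀ a b c → a +ᶻ b -ᶻ c +ᶻ + 2 *ᶻ c ≡ a +ᶻ b +ᶻ c
  lem = ℤ-Solver.solve-∀

C-absorb : ∀ n d → suc d * (suc n C suc d) ≡ suc n * (n C d)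
C-absorb n zero = trans (+-identityʳ _) (trans (nC1≡n (suc n))
    (trans (sym (*-identityʳ (suc n))) (cong (suc n *_) (sym (nC0≡1 n)))))
C-absorb zero (suc d) = trans (cong (suc (suc d) *_) (k>n⇒nCk≡0 {1} {suc (suc d)} (s<s z<s)))
  (trans (*-zeroʳ (suc (suc d))) (sym (cong (_+ 0) (k>n⇒nCk≡0 {0} {suc d} z<s))))
C-absorb (suc n) (suc d) = begin
  suc (suc d) * (suc (suc n) C suc (suc d))
    ≡⟨ cong (suc (suc d) *_) (C-1-pascal (suc n) (suc (suc d))) ⟩
  suc (suc d) * (suc n C suc (suc d) + suc n C suc d)
    ≡⟨ lem₁ d (suc n C suc (suc d)) (suc n C suc d) ⟩
  suc (suc d) * (suc n C suc (suc d)) + (suc d * (suc n C suc d) + suc n C suc d)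
    ≡⟨ cong₂ (λ a b → a + (b + suc n C suc d)) (C-absorb n (suc d)) (C-absorb n d) ⟩
  suc n * (n C suc d) + (suc n * (n C d) + suc n C suc d)
    ≡⟨ cong (λ t → suc n * (n C suc d) + (suc n * (n C d) + t)) (C-1-pascal n (suc d)) ⟩
  suc n * (n C suc d) + (suc n * (n C d) + (n C suc d + n C d))
    ≡⟨ lem₂ n (n C suc d) (n C d) ⟩
  suc (suc n) * (n C suc d + n C d)
    ≡⟨ cong (suc (suc n) *_) (C-1-pascal n (suc d)) ⟨
  suc (suc n) * (suc n C suc d) ∎
  where
  open ≡-Reasoning
  lem₁ : ∀ d a b → suc (suc d) * (a + b) ≡ suc (suc d) * a + (suc d * b + b)
  lem₁ = ℕ-Solver.solve-∀
  lem₂ : ∀ n a b → suc n * a + (suc n * b + (a + b)) ≡ suc (suc n) * (a + b)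
  lem₂ = ℕ-Solver.solve-∀

C-1-absorb : ∀ n d → d * (suc n C d) ≡ suc n * (n C-1 d)
C-1-absorb n zero    = sym (*-zeroʳ (suc n))
C-1-absorb n (suc d) = C-absorb n d

-- Turns the truncating division in `narayana` into an exact one; a negative quotient would
-- contradict the sign of the product.
divide-pos : ∀ a m z → + a ≡ + suc m *ᶻ z → z ≡ + (a / suc m)
divide-pos a m (+ k)    e = cong +_ (sym (trans (cong (_/ suc m)
    (trans (ℤₚ.+-injective (trans e (sym (ℤₚ.pos-* (suc m) k)))) (*-comm (suc m) k))) (m*n/n≡m k (suc m))))
divide-pos a m -[1+ k ] ()

-- After multiplication by m + 1, absorption turns the determinant into (d + 1)AB - dAB = AB.
refined-narayana : ∀ m d → refined m 1 d ≡ + narayana (suc m) d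
refined-narayana m d rewrite +-comm m 1 = divide-pos _ m _ (begin
  + (A * B)                                             ≡⟨ ℤₚ.pos-* A B ⟩
  + A *ᶻ + B                                            ≡⟨ lem (+ d) (+ A) (+ B) ⟩
  + A *ᶻ ((+ 1 +ᶻ + d) *ᶻ + B) -ᶻ (+ d *ᶻ + A) *ᶻ + B   ≡⟨ cong₂ (λ s t → + A *ᶻ s -ᶻ t *ᶻ + B) absorb₁ absorb₂ ⟩
  + A *ᶻ (+ suc m *ᶻ + (m C d)) -ᶻ (+ suc m *ᶻ + (m C-1 d)) *ᶻ + B
                                                        ≡⟨ lem′ (+ suc m) (+ A) (+ (m C d)) (+ (m C-1 d)) (+ B) ⟩
  + suc m *ᶻ (+ A *ᶻ + (m C d) -ᶻ + (m C-1 d) *ᶻ + B)   ∎)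
  where
  open ≡-Reasoning
  A B : ℕ
  A = suc m C d
  B = suc m C suc d
  absorb₁ : + suc d *ᶻ + B ≡ + suc m *ᶻ + (m C d)
  absorb₁ = trans (sym (ℤₚ.pos-* (suc d) B)) (trans (cong +_ (C-absorb m d)) (ℤₚ.pos-* (suc m) (m C d)))
  absorb₂ : + d *ᶻ + A ≡ + suc m *ᶻ + (m C-1 d)
  absorb₂ = trans (sym (ℤₚ.pos-* d A)) (trans (cong +_ (C-1-absorb m d)) (ℤₚ.pos-* (suc m) (m C-1 d)))
  lem : ∀ d a b → a *ᶻ b ≡ a *ᶻ ((+ 1 +ᶻ d) *ᶻ b) -ᶻ (d *ᶻ a) *ᶻ b
  lem = ℤ-Solver.solve-∀
  lem′ : ∀ n a p q b → a *ᶻ (n *ᶻ p) -ᶻ (n *ᶻ q) *ᶻ b ≡ n *ᶻ (a *ᶻ p -ᶻ q *ᶻ b)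
  lem′ = ℤ-Solver.solve-∀

narayana-sum : ∀ n → ∑ (suc n) (λ d → 2 ^ d * narayana (suc n) d) ≡ F (suc n) 0 one
narayana-sum n = ℤₚ.+-injective (trans (sym (∑ᶻ-∑ (suc n) _)) (trans
  (∑ᶻ-cong (suc n) (λ d → trans (ℤₚ.pos-* (2 ^ d) (narayana (suc n) d)) (cong (+ (2 ^ d) *ᶻ_) (sym (refined-narayana n d)))))
  (F-refined n 1 (suc n) (n<1+n n))))

-- The number of leaves

stopping : ℕ → ℕ
stopping j = count (λ c → containsStop c ∧ not (containsStop (restrict c))) (WOC j)

w-∑ : ∀ n → w n ≡ F n 0 one + ∑ n (stopping ∘ suc)
w-∑ n = cong₂ _+_ (avoiders-WOC n) (sum-upTo (stopping ∘ suc) n)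

F-siblings : ∀ n → F n 0 siblings ≡ F n 0 one + 2 * F n 0 id
F-siblings n = trans (F-cong n 0 (λ k → split k)) (trans (F-+ n 0 one (λ k → k + k))
  (cong (λ t → F n 0 one + t) (trans (F-+ n 0 id id) (double (F n 0 id)))))
  where
  split : ∀ k → suc k + k ≡ 1 + (k + k)
  split = ℕ-Solver.solve-∀
  double : ∀ a → a + a ≡ 2 * a
  double = ℕ-Solver.solve-∀

w-zero : w 0 ≡ 1
w-zero = w-∑ 0

-- Growing the tree by a level replaces an avoiding node with k blocks by its 2k + 1 children, a
-- gain of 2k leaves.
w-suc : ∀ n → w (suc n) ≡ w n + 2 * F n 0 id
w-suc n = begin
  w (suc n)                                                ≡⟨ w-∑ (suc n) ⟩
  F (suc n) 0 one + (s + stopping (suc n))                 ≡⟨ lem (F (suc n) 0 one) s (stopping (suc n)) ⟩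
  s + (stopping (suc n) + F (suc n) 0 one)                 ≡⟨ cong (λ t → s + t) (trans (stopping-leaves n) (F-siblings n)) ⟩
  s + (F n 0 one + 2 * F n 0 id)                           ≡⟨ lem′ s (F n 0 one) (2 * F n 0 id) ⟩
  F n 0 one + s + 2 * F n 0 id                             ≡⟨ cong (λ t → t + 2 * F n 0 id) (w-∑ n) ⟨
  w n + 2 * F n 0 id                                       ∎
  where
  open ≡-Reasoning
  s : ℕ
  s = ∑ n (stopping ∘ suc)
  lem : ∀ a b c → a + (b + c) ≡ b + (c + a)
  lem = ℕ-Solver.solve-∀
  lem′ : ∀ a b c → a + (b + c) ≡ b + a + c
  lem′ = ℕ-Solver.solve-∀

stopping-ell : ∀ n → stopping (suc n) ≡ sumFromTo 1 (suc n ∸ 2) (λ d → 2 ^ d * ell (suc n) d)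
stopping-ell n = trans
  (+-cancelʳ-≡ (F (suc n) 0 one) _ _ (trans (stopping-leaves n) (sym (first213-total n))))
  (trans (sym (ell-sum (suc n))) (sym (sum-upTo (λ d → 2 ^ suc d * ell (suc n) (suc d)) (suc n ∸ 2))))

w-formula : ∀ n → 1 ≤ n → w n ≡ wFormula n
w-formula (suc zero)    _ = refl
w-formula (suc (suc n)) _ = trans (w-∑ (suc (suc n))) (cong₂ _+_
  (trans (sym (narayana-sum (suc n))) (sym (sum-upTo _ (suc (suc n)))))
  -- The two terms split off are `stopping 1` and `stopping 2`, which compute to 0: three elements
  -- are needed, so the sum starts at j = 3.
  (trans (∑-suc (suc n) _) (trans (∑-suc n _)
    (trans (∑-cong n (λ i _ → stopping-ell (suc (suc i)))) (sym (sum-upTo _ n))))))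

-- A form of `w` that can be evaluated: `w n` filters all n^n lists, which is out of reach for the
-- ten listed values, whereas `F` follows its recursion.
leaves : ℕ → ℕ
leaves zero    = 1
leaves (suc n) = leaves n + 2 * F n 0 id

w≡leaves : ∀ n → w n ≡ leaves n
w≡leaves zero    = w-zero
w≡leaves (suc n) = trans (w-suc n) (cong (λ t → t + 2 * F n 0 id) (w≡leaves n))

Wseries-eq : Wseries ≋ X ⊛ (Wseries ⊕ const (+ 1) ⊕ const (+ 2) ⊛ Hˢ 0)
Wseries-eq = leaf-series Wseries refl (cong +_ (w≡leaves 1))
  (λ n → trans (cong +_ (w-suc (suc n))) (cong (λ t → + w (suc n) +ᶻ t) (ℤₚ.pos-* 2 (F (suc n) 0 id))))

theorem10 : ((n : ℕ) → 1 ≤ n → w n ≡ wFormula n)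
    × (map w (applyUpTo Data.Nat.suc 10) ≡ 1 ∷ 3 ∷ 13 ∷ 65 ∷ 341 ∷ 1827 ∷ 9913 ∷ 54273 ∷ 299209 ∷ 1658723 ∷ [])
    × ((S : FPS) → S 0 ≡ + 1
    → ((n : ℕ) → (S ⊛ S) n ≡ poly (+ 1 ∷ -[1+ 5 ] ∷ + 1 ∷ []) n)
    → (n : ℕ) → ((poly (+ 4 ∷ -[1+ 3 ] ∷ []) ⊛ S) ⊛ Wseries) n
    ≡ Data.Integer._-_ (poly (+ 1 ∷ -[1+ 1 ] ∷ + 1 ∷ []) n) ((poly (+ 1 ∷ -[1+ 2 ] ∷ []) ⊛ S) n))
theorem10 = w-formula
  , map-cong w≡leaves (applyUpTo suc 10)
  , generating-function Wseries Wseries-eq
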